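{- Let $N\ge2$, $0<\varepsilon\le\frac1{10}$, $0<\eta\le\frac13$, $\lambda=\frac{\varepsilon^2}{8N}$ and $\tilde p=32\frac{N^2}{\varepsilon^3\eta}\ln(N/\varepsilon)$. Take any SLAs $\beta(1),\dots,\beta(N)$ (not necessarily summing to at most $1$) such that $\frac{\beta(i)}{\sum_k\beta(k)}\ge\frac{e^{\eta(1+\lambda)}}{1-\varepsilon}\frac{\varepsilon}{N}$ for all $i$, and any loads $L_1,\dots,L_T\in\mathbb{R}_{\ge0}^N$. Then for any user $i$ and time $t\le T-\tilde p$, if $h_1',\dots,h_T'$ are allocations with $h_\tau'(i)=(1-2\varepsilon)\frac{\beta(i)}{\sum_k\beta(k)}$ for all $\tau$, the work done by Algorithm 2 (defined in the context, run with parameters $\varepsilon,\eta$) for user $i$ satisfies $$\sum_{\tau=1}^{t+\tilde p}w_\tau(i)\ \ge\ \sum_{\tau=1}^{t}w_\tau'(i),$$ where $w_\tau'$ is the work done by the allocations $h_1',\dots,h_T'$ on the same loads. Moreover, $\sum_{\tau=1}^t w_\tau(i)\ge\sum_{\tau=1}^t w_\tau'(i)-\frac{\beta(i)}{\sum_k\beta(k)}\tilde p$ for every $1\le t\le T$. (A sum up to $t+\tilde p$ is over all integers $\tau$ with $1\le\tau\le t+\tilde p$.)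
   Context: Model. There are $N\ge 2$ users sharing one resource of capacity $1$ over discrete times $t=1,\dots,T$. User $i$ has an SLA $\beta(i)\ge 0$ (with $\sum_k\beta(k)>0$). At time $t$ a load $L_t(i)\ge 0$ arrives for user $i$. Given allocations $h_1,\dots,h_T\in[0,1]^N$, the work and the queues are defined by $Q_1(i)=0$ and $$w_t(i)=\min\{h_t(i),\,L_t(i)+Q_t(i)\},\qquad Q_{t+1}(i)=\max\{0,\,L_t(i)+Q_t(i)-h_t(i)\}.$$ At time $t$ the only feedback is the set of active users $A_t=\{i: Q_t(i)>0\}$ and inactive users $B_t=\{1,\dots,N\}\setminus A_t$. Truncated simplex and projection. $\Delta_\varepsilon=\{x\in\mathbb{R}^N:\sum_i x(i)=1,\ x(i)\ge\varepsilon/N\ \forall i\}$, and for $y$ with positive entries $\pi_{\Delta_\varepsilon}(y)=\operatorname{argmin}_{x\in\Delta_\varepsilon}\sum_i x(i)\log(x(i)/y(i))$. Algorithm 2 (parameters $\varepsilon,\eta$). Set $\lambda=\frac{\varepsilon^2}{8N}$ and let $h_1$ be any element of $\Delta_\varepsilon$. For $t=1,\dots,T$: use allocation $h_t$; read $A_t,B_t$; let $A_t^1=\left\{i\in A_t:h_t(i)<(1-\varepsilon)\frac{\beta(i)}{\sum_{j\in A_t}\beta(j)}\right\}$ and $A_t^2=A_t\setminus A_t^1$; set $g_t(i)=1+\lambda$ for $i\in A_t^1$, $g_t(i)=1$ for $i\in A_t^2$, $g_t(i)=0$ for $i\in B_t$; set $\widehat h_{t+1}(i)=h_t(i)e^{\eta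 g_t(i)}$ and $h_{t+1}=\pi_{\Delta_\varepsilon}(\widehat h_{t+1})$. -}

module Defs where

open import Level using (_⊔_) renaming (suc to lsuc)
open import Algebra.Bundles using (CommutativeRing)
import Algebra.Construct.NaturalChoice.Max as Max
import Algebra.Construct.NaturalChoice.Min as Min
import Algebra.Properties.Semiring.Exp as Exp
import Algebra.Properties.Semiring.Mult as Mult
import Algebra.Properties.Semiring.Sum as Sum
open import Data.Bool.Base using (if_then_else_)
open import Data.Fin.Base using (Fin; toℕ)
open import Data.Nat.Base as ℕ using (ℕ; zero; suc)
open import Data.Product.Base using (∃; _×_)
open import Relation.Binary.Bundles using (DecTotalOrder)
open import Relation.Binary.Core using (Rel)
import Relation.Binary.Construct.NonStrictToStrict as ToStrict
open import Relation.Binary.Structures using (IsDecTotalOrder)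
open import Relation.Nullary.Decidable using (Dec; does)
open import Relation.Nullary.Negation using (¬_)
open import Relation.Unary using (Pred; Decidable)

-- The real numbers in the classical sense: a Dedekind-complete totally ordered
-- field, which is unique up to isomorphism, together with its exponential and
-- logarithm.  The operations _⁻¹ and ln are total, but nothing is
-- assumed about 0# ⁻¹ or about ln x for x not positive, except that _⁻¹ and ln
-- respect _≈_.
record RealNumbers c ℓ₁ ℓ₂ : Set (lsuc (c ⊔ ℓ₁ ⊔ ℓ₂)) where
  infix  8 _⁻¹
  infixl 7 _/_
  infix  4 _≤_ _<?_

  field
    commutativeRing : CommutativeRing c ℓ₁

  open CommutativeRing commutativeRing public renaming (Carrier to ℝ)

  field
    _⁻¹             : ℝ → ℝ
    ⁻¹-cong         : ∀ {x y} → x ≈ y → x ⁻¹ ≈ y ⁻¹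
    ⁻¹-inverseʳ     : ∀ {x} → ¬ x ≈ 0# → x * x ⁻¹ ≈ 1#
    0≉1             : ¬ 0# ≈ 1#

    _≤_             : Rel ℝ ℓ₂
    isDecTotalOrder : IsDecTotalOrder _≈_ _≤_
    +-monoˡ-≤       : ∀ z {x y} → x ≤ y → x + z ≤ y + z
    *-nonNeg        : ∀ {x y} → 0# ≤ x → 0# ≤ y → 0# ≤ x * y

  decTotalOrder : DecTotalOrder c ℓ₁ ℓ₂
  decTotalOrder = record { isDecTotalOrder = isDecTotalOrder }

  open DecTotalOrder decTotalOrder public using (totalOrder; _≟_; _≤?_)

  open ToStrict _≈_ _≤_ public
    using (<-decidable) renaming (_<_ to infix 4 _<_)

  UpperBound : ∀ {p} → Pred ℝ p → ℝ → Set (c ⊔ ℓ₂ ⊔ p)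
  UpperBound P b = ∀ x → P x → x ≤ b

  field
    supremum : (P : Pred ℝ (c ⊔ ℓ₁ ⊔ ℓ₂)) → ∃ P → ∃ (UpperBound P) →
               ∃ λ s → UpperBound P s × (∀ b → UpperBound P b → s ≤ b)

    -- Over a complete ordered field these three laws determine exp uniquely:
    -- for n > ∣x∣ they give (1 + x/n)ⁿ ≤ exp x ≤ (1 - x/n)⁻ⁿ.
    exp             : ℝ → ℝ
    exp-cong        : ∀ {x y} → x ≈ y → exp x ≈ exp y
    exp-+           : ∀ x y → exp (x + y) ≈ exp x * exp y
    1+x≤exp         : ∀ x → 1# + x ≤ exp x

    ln              : ℝ → ℝ
    ln-cong         : ∀ {x y} → x ≈ y → ln x ≈ ln y
    exp-ln          : ∀ {x} → 0# < x → exp (ln x) ≈ x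

  _<?_ : ∀ x y → Dec (x < y)
  _<?_ = <-decidable _≟_ _≤?_

  _/_ : ℝ → ℝ → ℝ
  x / y = x * y ⁻¹

  open Max totalOrder public using () renaming (_⊔_ to max)
  open Min totalOrder public using () renaming (_⊓_ to min)
  open Sum semiring public using (sum)
  open Exp semiring public using (_^_)
  open Mult semiring public using () renaming (_×_ to _·_)

  fromℕ : ℕ → ℝ
  fromℕ n = n · 1#

module Scheduling {c ℓ₁ ℓ₂} (R : RealNumbers c ℓ₁ ℓ₂) where
  open RealNumbers R

  -- Σ_{τ=1}^{t} f τ
  sumUpTo : ℕ → (ℕ → ℝ) → ℝ
  sumUpTo t f = sum {t} (λ k → f (suc (toℕ k)))

  -- The sum of f τ over the integers τ with 1 ≤ τ ≤ x.  The bound x is real, so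
  -- the sum is taken within the horizon 1, …, T, which loses no term if x ≤ T.
  sumUpToℝ : ℕ → ℝ → (ℕ → ℝ) → ℝ
  sumUpToℝ T x f = sumUpTo T (λ τ → if does (fromℕ τ ≤? x) then f τ else 0#)

  λ′ : (N : ℕ) (ε : ℝ) → ℝ
  λ′ N ε = (ε ^ 2) / (fromℕ 8 * fromℕ N)

  p̃ : (N : ℕ) (ε η : ℝ) → ℝ
  p̃ N ε η =
    (fromℕ 32 * ((fromℕ N ^ 2) / ((ε ^ 3) * η))) * ln (fromℕ N / ε)

  module _ {N : ℕ} where

    User : Set
    User = Fin N

    -- Loads, allocations, queues and work are indexed by time 1, 2, …; their
    -- values at time 0, and at times beyond the horizon, play no role.
    Trajectory : Set c
    Trajectory = ℕ → User → ℝ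

    share : (User → ℝ) → User → ℝ
    share β i = β i / sum β

    IsAllocation : (User → ℝ) → Set ℓ₂
    IsAllocation x = ∀ i → 0# ≤ x i × x i ≤ 1#

    queue : (L h : Trajectory) → Trajectory
    queue L h zero          i = 0#
    queue L h (suc zero)    i = 0#
    queue L h (suc (suc t)) i = max 0# ((L (suc t) i + queue L h (suc t) i) - h (suc t) i)

    work : (L h : Trajectory) → Trajectory
    work L h t i = min (h t i) (L t i + queue L h t i)

    TruncatedSimplex : ℝ → Pred (User → ℝ) (ℓ₁ ⊔ ℓ₂)
    TruncatedSimplex ε x = sum x ≈ 1# × (∀ i → ε / fromℕ N ≤ x i)

    relativeEntropy : (x y : User → ℝ) → ℝ
    relativeEntropy x y = sum (λ i → x i * ln (x i / y i))

    -- x is the minimiser of relativeEntropy _ y on the truncated simplex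
    IsProjection : (ε : ℝ) (y x : User → ℝ) → Set (c ⊔ ℓ₁ ⊔ ℓ₂)
    IsProjection ε y x =
      TruncatedSimplex ε x ×
      (∀ z → TruncatedSimplex ε z → relativeEntropy x y ≤ relativeEntropy z y)

    Active : (Q : User → ℝ) → Pred User (ℓ₁ ⊔ ℓ₂)
    Active Q i = 0# < Q i

    active? : (Q : User → ℝ) → Decidable (Active Q)
    active? Q i = 0# <? Q i

    activeSum : (Q β : User → ℝ) → ℝ
    activeSum Q β = sum (λ j → if does (active? Q j) then β j else 0#)

    gain : (ε : ℝ) (β Q x : User → ℝ) → User → ℝ
    gain ε β Q x i =
      if does (active? Q i)
      then (if does (x i <? ((1# - ε) * (β i / activeSum Q β)))
            then 1# + λ′ N ε
            else 1#)
      else 0#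

    multiplicativeUpdate : (ε η : ℝ) (β Q x : User → ℝ) → User → ℝ
    multiplicativeUpdate ε η β Q x i = x i * exp (η * gain ε β Q x i)

    record IsAlgorithm2Run (ε η : ℝ) (β : User → ℝ) (T : ℕ) (L h : Trajectory)
           : Set (c ⊔ ℓ₁ ⊔ ℓ₂) where
      field
        initial : TruncatedSimplex ε (h 1)
        step    : ∀ t → 1 ℕ.≤ t → t ℕ.≤ T →
                  IsProjection ε (multiplicativeUpdate ε η β (queue L h t) (h t)) (h (suc t))

{-# OPTIONS --safe #-}
module Submission where

-- Since the projection minimises relative entropy, a coordinate of h (t + 1)
-- above the floor a = ε / N is rescaled by at most the factor of any other one;
-- comparing the sums of h t and h (t + 1), both 1, turns this into growth bounds.
-- An active user with h t i < (1 - ε) β i / Σ_A β gains a factor 1 + δ, where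
-- 2 δ = η λ a: either some user in A² gains less than the maximal factor, or the
-- inactive users hold mass at least ε.  An active user at or above that threshold
-- loses at most a factor exp (- η λ).  Hence fewer than p̃ - 1 busy steps take h t i
-- from a to (1 - 2 ε) share β i, and it stays above this level while the user is
-- busy.  Up to the last idle time all load has been served, so only these steps
-- separate w from w′.

open import Defs
open import Data.Nat.Base as ℕ using (ℕ; zero; suc)
open import Data.Fin.Base using (Fin; zero; suc; toℕ)
open import Data.Product.Base using (∃; ∃₂; _×_; _,_; proj₁; proj₂)
open import Algebra.Solver.Ring.AlmostCommutativeRing using (fromCommutativeRing; _-Raw-AlmostCommutative⟶_)
open import Data.Bool.Base using (if_then_else_)
open import Data.Empty using (⊥; ⊥-elim)
open import Data.Integer.Base as ℤ using (ℤ; -[1+_])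
open import Data.Maybe.Base using (Maybe; just; nothing)
open import Data.Sum.Base using (_⊎_; inj₁; inj₂; [_,_]′)
open import Function.Base using (_∘_)
open import Level using (_⊔_)
open import Relation.Binary.Bundles using (DecTotalOrder)
open import Relation.Binary.PropositionalEquality.Core as ≡ using (_≡_)
open import Relation.Nullary.Decidable using (Dec; yes; no; does; _×-dec_; ¬?)
open import Relation.Nullary.Negation using (¬_; contradiction)
import Algebra.Construct.NaturalChoice.Max as Max
import Algebra.Construct.NaturalChoice.Min as Min
import Algebra.Properties.Ring as RingProperties
import Algebra.Properties.Semiring.Mult as Mult
import Algebra.Properties.Semiring.Sum as Sum
import Algebra.Solver.Ring as RingSolver
import Data.Fin.Properties as Fin
import Data.Integer.Properties as ℤ
import Data.Nat.Properties as ℕ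
import Relation.Binary.Construct.NonStrictToStrict as ToStrict
import Relation.Binary.Reasoning.Setoid as SetoidReasoning

-- The floor hides the normalising factor of the projection, so the update has no closed formula and
-- is bounded by contradiction. If an active user grew too little, every other coordinate would be
-- capped as well. Both allocations sum to 1, so caps whose total exceeds 1 by at most δ leave no
-- room for one coordinate to lie 2 δ below its cap. That saving is the relative loss η λ on a mass
-- of at least a. The lower bound on the SLAs serves the users in A²: each holds at least a exp (η
-- (1 + λ)), so one that lands on the floor has already shrunk by the full factor and needs no
-- separate treatment.

-- Ring identities with integer coefficients

module IntegerSolver {c ℓ₁ ℓ₂} (R : RealNumbers c ℓ₁ ℓ₂) where
  open RealNumbers R hiding (zero)
  open RingProperties ring
  open Mult semiring using (×-homo-+; ×1-homo-*)
  open SetoidReasoning setoid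

  -- 1 is sent to 1# and n ≥ 2 to fromℕ n, so that the numerals 1# and
  -- fromℕ n of a goal are, up to reduction, the constants of the solver.
  fromℤ : ℤ → ℝ
  fromℤ (ℤ.+ 0)     = 0#
  fromℤ (ℤ.+ 1)     = 1#
  fromℤ (ℤ.+ n)     = fromℕ n
  fromℤ (-[1+ 0 ])  = - 1#
  fromℤ (-[1+ n ])  = - fromℕ (suc n)

  fromℤ-+ : ∀ n → fromℤ (ℤ.+ n) ≈ fromℕ n
  fromℤ-+ 0 = refl
  fromℤ-+ 1 = sym (+-identityʳ 1#)
  fromℤ-+ (suc (suc n)) = refl

  fromℤ-neg-suc : ∀ n → fromℤ -[1+ n ] ≈ - fromℕ (suc n)
  fromℤ-neg-suc 0 = -‿cong (sym (+-identityʳ 1#))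
  fromℤ-neg-suc (suc n) = refl

  fromℤ-neg : ∀ i → fromℤ (ℤ.- i) ≈ - fromℤ i
  fromℤ-neg (ℤ.+ 0)     = sym -0#≈0#
  fromℤ-neg (ℤ.+ suc n) = trans (fromℤ-neg-suc n) (-‿cong (sym (fromℤ-+ (suc n))))
  fromℤ-neg -[1+ n ]    = begin
    fromℤ (ℤ.+ suc n)      ≈⟨ fromℤ-+ (suc n) ⟩
    fromℕ (suc n)          ≈⟨ -‿involutive _ ⟨
    - - fromℕ (suc n)      ≈⟨ -‿cong (fromℤ-neg-suc n) ⟨
    - fromℤ -[1+ n ]       ∎

  1+x-[1+y]≈x-y : ∀ x y → (1# + x) - (1# + y) ≈ x - y
  1+x-[1+y]≈x-y x y = begin
    (1# + x) - (1# + y)     ≈⟨ +-cong (+-comm 1# x) (sym (-‿+-comm 1# y)) ⟩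
    (x + 1#) + (- 1# - y)   ≈⟨ +-assoc x 1# _ ⟩
    x + (1# + (- 1# - y))   ≈⟨ +-congˡ (+-assoc 1# (- 1#) (- y)) ⟨
    x + ((1# - 1#) - y)     ≈⟨ +-congˡ (+-congʳ (-‿inverseʳ 1#)) ⟩
    x + (0# - y)            ≈⟨ +-congˡ (+-identityˡ (- y)) ⟩
    x - y                   ∎

  fromℤ-⊖ : ∀ m n → fromℤ (m ℤ.⊖ n) ≈ fromℕ m - fromℕ n
  fromℤ-⊖ m zero = begin
    fromℤ (m ℤ.⊖ 0)         ≡⟨ ≡.cong fromℤ (ℤ.⊖-≥ {m} {0} ℕ.z≤n) ⟩
    fromℤ (ℤ.+ m)           ≈⟨ fromℤ-+ m ⟩
    fromℕ m                 ≈⟨ +-identityʳ _ ⟨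
    fromℕ m + 0#            ≈⟨ +-congˡ -0#≈0# ⟨
    fromℕ m - 0#            ∎
  fromℤ-⊖ zero (suc n) = trans (fromℤ-neg-suc n) (sym (+-identityˡ _))
  fromℤ-⊖ (suc m) (suc n) = begin
    fromℤ (suc m ℤ.⊖ suc n)        ≡⟨ ≡.cong fromℤ (ℤ.[1+m]⊖[1+n]≡m⊖n m n) ⟩
    fromℤ (m ℤ.⊖ n)                ≈⟨ fromℤ-⊖ m n ⟩
    fromℕ m - fromℕ n              ≈⟨ 1+x-[1+y]≈x-y _ _ ⟨
    fromℕ (suc m) - fromℕ (suc n)  ∎

  fromℤ-homo-+ : ∀ i j → fromℤ (i ℤ.+ j) ≈ fromℤ i + fromℤ j
  fromℤ-homo-+ (ℤ.+ m) (ℤ.+ n) = begin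
    fromℤ (ℤ.+ (m ℕ.+ n))          ≈⟨ fromℤ-+ (m ℕ.+ n) ⟩
    fromℕ (m ℕ.+ n)                ≈⟨ ×-homo-+ 1# m n ⟩
    fromℕ m + fromℕ n              ≈⟨ +-cong (fromℤ-+ m) (fromℤ-+ n) ⟨
    fromℤ (ℤ.+ m) + fromℤ (ℤ.+ n)  ∎
  fromℤ-homo-+ (ℤ.+ m) -[1+ n ] =
    trans (fromℤ-⊖ m (suc n)) (sym (+-cong (fromℤ-+ m) (fromℤ-neg-suc n)))
  fromℤ-homo-+ -[1+ m ] (ℤ.+ n) =
    trans (fromℤ-⊖ n (suc m))
      (trans (+-comm _ _) (sym (+-cong (fromℤ-neg-suc m) (fromℤ-+ n))))
  fromℤ-homo-+ -[1+ m ] -[1+ n ] = begin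
    - fromℕ (suc (suc (m ℕ.+ n)))       ≡⟨ ≡.cong (λ k → - fromℕ (suc k)) (ℕ.+-suc m n) ⟨
    - fromℕ (suc m ℕ.+ suc n)           ≈⟨ -‿cong (×-homo-+ 1# (suc m) (suc n)) ⟩
    - (fromℕ (suc m) + fromℕ (suc n))   ≈⟨ -‿+-comm _ _ ⟨
    - fromℕ (suc m) - fromℕ (suc n)     ≈⟨ +-cong (fromℤ-neg-suc m) (fromℤ-neg-suc n) ⟨
    fromℤ -[1+ m ] + fromℤ -[1+ n ]     ∎

  fromℤ-homo-*⁺ : ∀ m n → fromℤ (ℤ.+ m ℤ.* ℤ.+ n) ≈ fromℤ (ℤ.+ m) * fromℤ (ℤ.+ n)
  fromℤ-homo-*⁺ m n = begin
    fromℤ (ℤ.+ m ℤ.* ℤ.+ n)        ≡⟨ ≡.cong fromℤ (ℤ.pos-* m n) ⟨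
    fromℤ (ℤ.+ (m ℕ.* n))          ≈⟨ fromℤ-+ (m ℕ.* n) ⟩
    fromℕ (m ℕ.* n)                ≈⟨ ×1-homo-* m n ⟩
    fromℕ m * fromℕ n              ≈⟨ *-cong (fromℤ-+ m) (fromℤ-+ n) ⟨
    fromℤ (ℤ.+ m) * fromℤ (ℤ.+ n)  ∎

  fromℤ-homo-*ʳ : ∀ m j → fromℤ (ℤ.+ m ℤ.* j) ≈ fromℤ (ℤ.+ m) * fromℤ j
  fromℤ-homo-*ʳ m (ℤ.+ n) = fromℤ-homo-*⁺ m n
  fromℤ-homo-*ʳ m -[1+ n ] = begin
    fromℤ (ℤ.+ m ℤ.* -[1+ n ])              ≡⟨ ≡.cong fromℤ (ℤ.neg-distribʳ-* (ℤ.+ m) (ℤ.+ suc n)) ⟨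
    fromℤ (ℤ.- (ℤ.+ m ℤ.* ℤ.+ suc n))       ≈⟨ fromℤ-neg (ℤ.+ m ℤ.* ℤ.+ suc n) ⟩
    - fromℤ (ℤ.+ m ℤ.* ℤ.+ suc n)           ≈⟨ -‿cong (fromℤ-homo-*⁺ m (suc n)) ⟩
    - (fromℤ (ℤ.+ m) * fromℤ (ℤ.+ suc n))   ≈⟨ -‿distribʳ-* _ _ ⟩
    fromℤ (ℤ.+ m) * - fromℤ (ℤ.+ suc n)     ≈⟨ *-congˡ (fromℤ-neg (ℤ.+ suc n)) ⟨
    fromℤ (ℤ.+ m) * fromℤ -[1+ n ]          ∎

  fromℤ-homo-* : ∀ i j → fromℤ (i ℤ.* j) ≈ fromℤ i * fromℤ j
  fromℤ-homo-* (ℤ.+ m) j = fromℤ-homo-*ʳ m j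
  fromℤ-homo-* -[1+ m ] j = begin
    fromℤ (-[1+ m ] ℤ.* j)              ≡⟨ ≡.cong fromℤ (ℤ.neg-distribˡ-* (ℤ.+ suc m) j) ⟨
    fromℤ (ℤ.- (ℤ.+ suc m ℤ.* j))       ≈⟨ fromℤ-neg (ℤ.+ suc m ℤ.* j) ⟩
    - fromℤ (ℤ.+ suc m ℤ.* j)           ≈⟨ -‿cong (fromℤ-homo-*ʳ (suc m) j) ⟩
    - (fromℤ (ℤ.+ suc m) * fromℤ j)     ≈⟨ -‿distribˡ-* _ _ ⟩
    - fromℤ (ℤ.+ suc m) * fromℤ j       ≈⟨ *-congʳ (fromℤ-neg (ℤ.+ suc m)) ⟨
    fromℤ -[1+ m ] * fromℤ j            ∎

  fromℤ-morphism : ℤ.+-*-rawRing -Raw-AlmostCommutative⟶ fromCommutativeRing commutativeRing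
  fromℤ-morphism = record
    { ⟦_⟧    = fromℤ
    ; +-homo = fromℤ-homo-+
    ; *-homo = fromℤ-homo-*
    ; -‿homo = fromℤ-neg
    ; 0-homo = refl
    ; 1-homo = refl
    }

  fromℤ-≟ : ∀ i j → Maybe (fromℤ i ≈ fromℤ j)
  fromℤ-≟ i j with i ℤ.≟ j
  ... | yes ≡.refl = just refl
  ... | no _       = nothing

  open RingSolver ℤ.+-*-rawRing (fromCommutativeRing commutativeRing)
    fromℤ-morphism fromℤ-≟ public


-- Ordered field arithmetic

module OrderedField {c ℓ₁ ℓ₂} (R : RealNumbers c ℓ₁ ℓ₂) where
  open RealNumbers R hiding (zero)
  open IntegerSolver R using (solve; _:=_; _:+_; _:*_; _:-_; :-_; con; Polynomial)
  open Sum semiring using (∑-distrib-+; *-distribˡ-sum)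
  open DecTotalOrder decTotalOrder public using (≤-respˡ-≈; ≤-respʳ-≈)
    renaming (reflexive to ≤-reflexive; refl to ≤-refl; trans to ≤-trans;
              antisym to ≤-antisym; total to ≤-total)

  num : ∀ {m} → ℕ → Polynomial m
  num n = con (ℤ.+ n)

  <⇒≤ : ∀ {x y} → x < y → x ≤ y
  <⇒≤ = proj₁

  ≰⇒> : ∀ {x y} → ¬ x ≤ y → y < x
  ≰⇒> = ToStrict.≰⇒> _≈_ _≤_ sym ≤-reflexive ≤-total

  <⇒≱ : ∀ {x y} → x < y → ¬ y ≤ x
  <⇒≱ = ToStrict.<⇒≱ _≈_ _≤_ ≤-antisym

  ≮⇒≥ : ∀ {x y} → ¬ x < y → y ≤ x
  ≮⇒≥ = ToStrict.≮⇒≥ _≈_ _≤_ sym _≟_ ≤-reflexive ≤-total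

  <-≤-trans : ∀ {x y z} → x < y → y ≤ z → x < z
  <-≤-trans = ToStrict.<-≤-trans _≈_ _≤_ sym ≤-trans ≤-antisym ≤-respʳ-≈

  ≤-<-trans : ∀ {x y z} → x ≤ y → y < z → x < z
  ≤-<-trans = ToStrict.≤-<-trans _≈_ _≤_ ≤-trans ≤-antisym ≤-respˡ-≈

  <-respʳ-≈ : ∀ {x y z} → y ≈ z → x < y → x < z
  <-respʳ-≈ y≈z x<y = <-≤-trans x<y (≤-reflexive y≈z)

  -- An inequality x ≤ y is proved by ≤-by from an expression of y - x as a sum
  -- of products of terms known to be nonnegative, combined with _⊞_ and _⊠_.
  infixl 6 _⊞_ _⊞ˡ_
  infixl 7 _⊠_ _⊠⁺_

  _⊞_ : ∀ {x y} → 0# ≤ x → 0# ≤ y → 0# ≤ x + y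
  _⊞_ {x} {y} p q = ≤-trans q (≤-respˡ-≈ (+-identityˡ y) (+-monoˡ-≤ y p))

  _⊠_ : ∀ {x y} → 0# ≤ x → 0# ≤ y → 0# ≤ x * y
  _⊠_ = *-nonNeg

  diff : ∀ {x y} → x ≤ y → 0# ≤ y - x
  diff {x} p = ≤-respˡ-≈ (-‿inverseʳ x) (+-monoˡ-≤ (- x) p)

  ≤-by : ∀ {x y e} → 0# ≤ e → e ≈ y - x → x ≤ y
  ≤-by {x} {y} p eq =
    ≤-respʳ-≈ (solve 2 (λ x y → y :- x :+ x := y) refl x y)
      (≤-respˡ-≈ (+-identityˡ x) (+-monoˡ-≤ x (≤-respʳ-≈ eq p)))

  diff⁺ : ∀ {x y} → x < y → 0# < y - x
  diff⁺ {x} {y} p =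
    ≰⇒> (λ q → <⇒≱ p (≤-by (diff q) (solve 2 (λ x y → num 0 :- (y :- x) := x :- y) refl x y)))

  <-by : ∀ {x y e} → 0# < e → e ≈ y - x → x < y
  <-by {x} {y} p eq =
    ≰⇒> (λ q → <⇒≱ p (≤-by (diff q)
      (trans (solve 2 (λ x y → x :- y := num 0 :- (y :- x)) refl x y)
             (+-congˡ (-‿cong (sym eq))))))

  _⊞ˡ_ : ∀ {x y} → 0# < x → 0# ≤ y → 0# < x + y
  _⊞ˡ_ {x} {y} p q = <-≤-trans p (≤-by q (solve 2 (λ x y → y := x :+ y :- x) refl x y))

  0≤1 : 0# ≤ 1#
  0≤1 = [ (λ p → p) , (λ p → ⊥-elim (0≉1 (≤-antisym (0≤[-1]² p) p))) ]′ (≤-total 0# 1#)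
    where
    0≤[-1]² : 1# ≤ 0# → 0# ≤ 1#
    0≤[-1]² p = ≤-respʳ-≈ (solve 0 ((num 0 :- num 1) :* (num 0 :- num 1) := num 1) refl)
                          (diff p ⊠ diff p)

  0<1 : 0# < 1#
  0<1 = 0≤1 , 0≉1

  _⊠⁺_ : ∀ {x y} → 0# < x → 0# < y → 0# < x * y
  _⊠⁺_ {x} {y} p q = <⇒≤ p ⊠ <⇒≤ q , λ 0≈xy → proj₂ q (begin
    0#                ≈⟨ zeroˡ _ ⟨
    0# * x ⁻¹         ≈⟨ *-congʳ 0≈xy ⟩
    (x * y) * x ⁻¹    ≈⟨ solve 3 (λ x y z → (x :* y) :* z := (x :* z) :* y) refl x y (x ⁻¹) ⟩
    (x * x ⁻¹) * y    ≈⟨ *-congʳ (⁻¹-inverseʳ (λ x≈0 → proj₂ p (sym x≈0))) ⟩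
    1# * y            ≈⟨ *-identityˡ y ⟩
    y                 ∎)
    where open SetoidReasoning setoid

  *-cancelʳ-≤ : ∀ {x y z} → 0# < z → x * z ≤ y * z → x ≤ y
  *-cancelʳ-≤ {x} {y} {z} 0<z p =
    ≮⇒≥ λ y<x → <⇒≱ (<-by (diff⁺ y<x ⊠⁺ 0<z)
      (solve 3 (λ x y z → (x :- y) :* z := x :* z :- y :* z) refl x y z)) p

  *-cancelʳ-≈ : ∀ {x y z} → 0# < z → x * z ≈ y * z → x ≈ y
  *-cancelʳ-≈ 0<z eq =
    ≤-antisym (*-cancelʳ-≤ 0<z (≤-reflexive eq)) (*-cancelʳ-≤ 0<z (≤-reflexive (sym eq)))

  *-monoʳ-≤ : ∀ {x y z} → 0# ≤ z → x ≤ y → x * z ≤ y * z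
  *-monoʳ-≤ {x} {y} {z} 0≤z p =
    ≤-by (diff p ⊠ 0≤z) (solve 3 (λ x y z → (y :- x) :* z := y :* z :- x :* z) refl x y z)

  ⁻¹-inverse : ∀ {x} → 0# < x → x * x ⁻¹ ≈ 1#
  ⁻¹-inverse p = ⁻¹-inverseʳ (λ x≈0 → proj₂ p (sym x≈0))

  ⁻¹-pos : ∀ {x} → 0# < x → 0# < x ⁻¹
  ⁻¹-pos {x} p = ≰⇒> λ q → <⇒≱ 0<1
    (≤-by (<⇒≤ p ⊠ diff q) (trans (solve 2 (λ x y → x :* (num 0 :- y) := num 0 :- x :* y) refl x (x ⁻¹))
      (+-congˡ (-‿cong (⁻¹-inverse p)))))

  x/y*y≈x : ∀ x {y} → 0# < y → x / y * y ≈ x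
  x/y*y≈x x {y} p = trans (solve 3 (λ x y z → x :* z :* y := x :* (y :* z)) refl x y (y ⁻¹))
    (trans (*-congˡ (⁻¹-inverse p)) (*-identityʳ x))

  /-pos : ∀ {x y} → 0# < x → 0# < y → 0# < x / y
  /-pos p q = p ⊠⁺ ⁻¹-pos q

  0≤fromℕ : ∀ n → 0# ≤ fromℕ n
  0≤fromℕ zero = ≤-refl
  0≤fromℕ (suc n) = 0≤1 ⊞ 0≤fromℕ n

  0<fromℕ : ∀ n → 0# < fromℕ (suc n)
  0<fromℕ n = 0<1 ⊞ˡ 0≤fromℕ n

  fromℕ-mono : ∀ {m n} → m ℕ.≤ n → fromℕ m ≤ fromℕ n
  fromℕ-mono {n = n} ℕ.z≤n = 0≤fromℕ n
  fromℕ-mono (ℕ.s≤s p) = ≤-by (diff (fromℕ-mono p))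
    (solve 2 (λ x y → y :- x := (num 1 :+ y) :- (num 1 :+ x)) refl _ _)

  fromℕ-cancel : ∀ {m n} → fromℕ m ≤ fromℕ n → m ℕ.≤ n
  fromℕ-cancel {m} {n} p with m ℕ.≤? n
  ... | yes q = q
  ... | no q  = ⊥-elim (<⇒≱
    (<-by {x = fromℕ n} (0<1 ⊞ˡ ≤-refl) (solve 1 (λ x → num 1 :+ num 0 := num 1 :+ x :- x) refl _))
    (≤-trans (fromℕ-mono (ℕ.≰⇒> q)) p))

  -- The bound fromℕ n ≥ x replaces the Archimedean property.
  floor : ∀ x → 0# ≤ x → ∀ n → x ≤ fromℕ n → ∃ λ m → fromℕ m ≤ x × x < fromℕ (suc m)
  floor x 0≤x zero x≤0 = 0 , 0≤x , ≤-<-trans x≤0 (0<fromℕ 0)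
  floor x 0≤x (suc n) x≤n+1 with fromℕ n ≤? x | x ≟ fromℕ (suc n)
  ... | yes n≤x | no x≉n+1  = n , n≤x , (x≤n+1 , x≉n+1)
  ... | yes n≤x | yes x≈n+1 = suc n , ≤-reflexive (sym x≈n+1) ,
    <-by 0<1 (trans (solve 1 (λ y → num 1 := num 1 :+ y :- y) refl (fromℕ (suc n)))
                    (+-congˡ (-‿cong (sym x≈n+1))))
  ... | no n≰x  | _ = floor x 0≤x n (<⇒≤ (≰⇒> n≰x))

  -- Exponential and logarithm

  exp-0 : exp 0# ≈ 1#
  exp-0 = ≤-antisym
    -- The addition law makes `exp 0#` idempotent, and an idempotent above 1 would give a positive
    -- product equal to 0.
    (≮⇒≥ λ 1<e → proj₂ (e>0 ⊠⁺ diff⁺ 1<e) (sym e[e-1]≈0))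
    (≤-respˡ-≈ (+-identityʳ 1#) (1+x≤exp 0#))
    where
    e>0 : 0# < exp 0#
    e>0 = <-≤-trans (<-respʳ-≈ (sym (+-identityʳ 1#)) 0<1) (1+x≤exp 0#)

    e[e-1]≈0 : exp 0# * (exp 0# - 1#) ≈ 0#
    e[e-1]≈0 = trans (solve 1 (λ e → e :* (e :- num 1) := e :* e :- e) refl (exp 0#))
      (trans (+-congʳ (trans (sym (exp-+ 0# 0#)) (exp-cong (+-identityʳ 0#)))) (-‿inverseʳ (exp 0#)))

  exp-neg : ∀ x → exp x * exp (- x) ≈ 1#
  exp-neg x = trans (sym (exp-+ x (- x))) (trans (exp-cong (-‿inverseʳ x)) exp-0)

  exp-pos : ∀ x → 0# < exp x
  exp-pos x with ≤-total 0# x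
  ... | inj₁ 0≤x = <-≤-trans (0<1 ⊞ˡ 0≤x) (1+x≤exp x)
  ... | inj₂ x≤0 = ≰⇒> λ exp≤0 → <⇒≱ 0<1
    (≤-by (diff exp≤0 ⊠ <⇒≤ exp[-x]>0)
      (trans (solve 2 (λ e f → (num 0 :- e) :* f := num 0 :- e :* f) refl (exp x) (exp (- x)))
        (+-congˡ (-‿cong (exp-neg x)))))
    where
    exp[-x]>0 : 0# < exp (- x)
    exp[-x]>0 = <-≤-trans (0<1 ⊞ˡ ≤-respʳ-≈ (+-identityˡ (- x)) (diff x≤0)) (1+x≤exp (- x))

  exp-tangent : ∀ x y → exp x * (1# + (y - x)) ≤ exp y
  exp-tangent x y = ≤-by (<⇒≤ (exp-pos x) ⊠ diff (1+x≤exp (y - x)))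
    (trans (solve 3 (λ e f z → e :* (f :- z) := e :* f :- e :* z) refl (exp x) (exp (y - x)) (1# + (y - x)))
      (+-congʳ (trans (sym (exp-+ x (y - x)))
        (exp-cong (solve 2 (λ x y → x :+ (y :- x) := y) refl x y)))))

  exp-mono : ∀ {x y} → x ≤ y → exp x ≤ exp y
  exp-mono {x} {y} p = ≤-trans
    (≤-by (<⇒≤ (exp-pos x) ⊠ diff p)
      (solve 3 (λ e x y → e :* (y :- x) := e :* (num 1 :+ (y :- x)) :- e) refl (exp x) x y))
    (exp-tangent x y)

  ln-mono-< : ∀ {x y} → 0# < x → 0# < y → x < y → ln x < ln y
  ln-mono-< p q x<y = ≰⇒> λ r → <⇒≱ x<y
    (≤-respˡ-≈ (exp-ln q) (≤-respʳ-≈ (exp-ln p) (exp-mono r)))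

  -- This is 1 + z ≤ exp z at z = - ln x. The reciprocal is a variable of its own so that the floor
  -- a can stand for the reciprocal of n / ε.
  1-x⁻¹≤ln : ∀ {x y} → 0# < x → y * x ≈ 1# → 1# - y ≤ ln x
  1-x⁻¹≤ln {x} {y} 0<x yx≈1 = ≤-by (diff (1+x≤exp (- ln x)))
    (trans (solve 2 (λ e l → e :- (num 1 :+ :- l) := l :- (num 1 :- e)) refl (exp (- ln x)) (ln x))
      (+-congˡ (-‿cong (+-congˡ (-‿cong exp[-ln]≈y)))))
    where
    open SetoidReasoning setoid
    exp[-ln]≈y : exp (- ln x) ≈ y
    exp[-ln]≈y = begin
      exp (- ln x)                  ≈⟨ *-identityˡ _ ⟨
      1# * exp (- ln x)             ≈⟨ *-congʳ yx≈1 ⟨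
      (y * x) * exp (- ln x)        ≈⟨ *-congʳ (*-congˡ (exp-ln 0<x)) ⟨
      (y * exp (ln x)) * exp (- ln x) ≈⟨ *-assoc _ _ _ ⟩
      y * (exp (ln x) * exp (- ln x)) ≈⟨ *-congˡ (exp-neg (ln x)) ⟩
      y * 1#                        ≈⟨ *-identityʳ y ⟩
      y                             ∎

  -- Convexity of z ↦ z ln (z / y).
  ln-tangent : ∀ {x z y} → 0# < x → 0# < z → 0# < y →
               z * ln (z / y) - x * ln (x / y) ≤ (z - x) * (ln (z / y) + 1#)
  ln-tangent {x} {z} {y} 0<x 0<z 0<y = ≤-by (diff x[1+p-q]≤z)
    (solve 4 (λ x z p q → z :- x :* (num 1 :+ (p :- q))
                := (z :- x) :* (p :+ num 1) :- (z :* p :- x :* q)) refl x z p q)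
    where
    p q : ℝ
    p = ln (z / y)
    q = ln (x / y)

    x[1+p-q]≤z : x * (1# + (p - q)) ≤ z
    x[1+p-q]≤z = ≤-respˡ-≈
      (trans (*-congʳ (*-congʳ (exp-ln (/-pos 0<x 0<y))))
        (trans (solve 3 (λ w r y → w :* r :* y := w :* y :* r) refl (x / y) (1# + (p - q)) y)
          (*-congʳ (x/y*y≈x x 0<y))))
      (≤-respʳ-≈ (trans (*-congʳ (exp-ln (/-pos 0<z 0<y))) (x/y*y≈x z 0<y))
        (*-monoʳ-≤ (<⇒≤ 0<y) (exp-tangent q p)))

  if-true : ∀ {p} {P : Set p} (P? : Dec P) → P → ∀ {x y : ℝ} → (if does P? then x else y) ≈ x
  if-true (yes _) _ = refl
  if-true (no ¬p) p = contradiction p ¬p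

  if-false : ∀ {p} {P : Set p} (P? : Dec P) → ¬ P → ∀ {x y : ℝ} → (if does P? then x else y) ≈ y
  if-false (yes p) ¬p = contradiction p ¬p
  if-false (no _)  _  = refl

  -- Finite sums

  sum-cong : ∀ {n} {f g : Fin n → ℝ} → (∀ i → f i ≈ g i) → sum f ≈ sum g
  sum-cong = Sum.sum-cong-≋ semiring

  sum-mono : ∀ {n} {f g : Fin n → ℝ} → (∀ i → f i ≤ g i) → sum f ≤ sum g
  sum-mono {zero} p = ≤-refl
  sum-mono {suc n} p = ≤-by (diff (p zero) ⊞ diff (sum-mono (p ∘ suc)))
    (solve 4 (λ a b c d → (b :- a) :+ (d :- c) := b :+ d :- (a :+ c)) refl _ _ _ _)

  sum-+-* : ∀ {n} (f : Fin n → ℝ) x (g : Fin n → ℝ) → sum (λ i → f i + x * g i) ≈ sum f + x * sum g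
  sum-+-* f x g = trans (∑-distrib-+ f (λ i → x * g i)) (+-congˡ (sym (*-distribˡ-sum x g)))

  sum-1 : ∀ n → sum {n} (λ _ → 1#) ≈ fromℕ n
  sum-1 n = Sum.sum-replicate semiring n

  -- Changing a vector at k by adding a multiple of `unit k` keeps its sum computable by linearity,
  -- even when two changed coordinates coincide.
  unit : ∀ {n} → Fin n → Fin n → ℝ
  unit k j = if does (k Fin.≟ j) then 1# else 0#

  0≤unit : ∀ {n} (k j : Fin n) → 0# ≤ unit k j
  0≤unit k j with k Fin.≟ j
  ... | yes _ = 0≤1
  ... | no _  = ≤-refl

  unit≤1 : ∀ {n} (k j : Fin n) → unit k j ≤ 1#
  unit≤1 k j with k Fin.≟ j
  ... | yes _ = ≤-refl
  ... | no _  = 0≤1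

  sum-unit-* : ∀ {n} (k : Fin n) (f : Fin n → ℝ) → sum (λ j → unit k j * f j) ≈ f k
  sum-unit-* {suc n} zero f = trans (+-cong (*-identityˡ _) (sum-0* (f ∘ suc))) (+-identityʳ _)
    where
    sum-0* : ∀ {n} (f : Fin n → ℝ) → sum (λ j → 0# * f j) ≈ 0#
    sum-0* f = trans (sym (*-distribˡ-sum 0# f)) (zeroˡ _)
  sum-unit-* {suc n} (suc k) f = trans (+-cong (zeroˡ _) (sum-unit-* k (f ∘ suc))) (+-identityˡ _)

  sum-unit : ∀ {n} (k : Fin n) → sum (unit k) ≈ 1#
  sum-unit k = trans (sum-cong (λ j → sym (*-identityʳ (unit k j)))) (sum-unit-* k (λ _ → 1#))

  sum-single : ∀ {n} {f : Fin n → ℝ} → (∀ j → 0# ≤ f j) → ∀ k → f k ≤ sum f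
  sum-single {f = f} p k = ≤-respˡ-≈ (sum-unit-* k f) (sum-mono λ j →
    ≤-by (p j ⊠ diff (unit≤1 k j)) (solve 2 (λ f e → f :* (num 1 :- e) := f :- e :* f) refl (f j) (unit k j)))

-- Optimality of the entropy projection

module Projection {c ℓ₁ ℓ₂} (R : RealNumbers c ℓ₁ ℓ₂) where
  open RealNumbers R hiding (zero)
  open Scheduling R
  open IntegerSolver R using (solve; _:=_; _:+_; _:*_; _:-_; :-_)
  open OrderedField R

  -- The amount of mass to move in `projection-ratio`: the bound p keeps the donor above the floor,
  -- and the bound by q keeps the strict order of the two ratios after the move.
  small-step : ∀ {p q S} → 0# < p → 0# < q → 0# < S → ∃ λ s → 0# < s × s ≤ p × s * S < q
  small-step {p} {q} {S} 0<p 0<q 0<S = choose (p ≤? r)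
    where
    r : ℝ
    r = q / (S + S)

    0<S+S : 0# < S + S
    0<S+S = 0<S ⊞ˡ <⇒≤ 0<S

    0<r : 0# < r
    0<r = /-pos 0<q 0<S+S

    rS<q : r * S < q
    rS<q = <-by (0<r ⊠⁺ 0<S)
      (trans (solve 2 (λ r S → r :* S := r :* (S :+ S) :- r :* S) refl r S)
        (+-congʳ (x/y*y≈x q 0<S+S)))

    choose : Dec (p ≤ r) → ∃ λ s → 0# < s × s ≤ p × s * S < q
    choose (yes p≤r) = p , 0<p , ≤-refl , ≤-<-trans (*-monoʳ-≤ (<⇒≤ 0<S) p≤r) rS<q
    choose (no p≰r)  = r , 0<r , <⇒≤ (≰⇒> p≰r) , rS<q

  /-mono-< : ∀ {a b c d} → 0# < b → 0# < d → a * d < c * b → a / b < c / d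
  /-mono-< {a} {b} {c} {d} 0<b 0<d ad<cb = ≰⇒> λ c/d≤a/b → <⇒≱ ad<cb
    (≤-respˡ-≈ (trans (solve 3 (λ w d b → w :* (d :* b) := w :* d :* b) refl (c / d) d b)
                 (*-congʳ (x/y*y≈x c 0<d)))
      (≤-respʳ-≈ (trans (solve 3 (λ w d b → w :* (d :* b) := w :* b :* d) refl (a / b) d b)
                   (*-congʳ (x/y*y≈x a 0<b)))
        (*-monoʳ-≤ (<⇒≤ (0<d ⊠⁺ 0<b)) c/d≤a/b)))

  -- First-order optimality: if x j / y j > x k / y k, moving a little mass from
  -- j to k decreases the relative entropy.
  projection-ratio : ∀ {N} {ε} {x y : Fin N → ℝ} → 0# < ε / fromℕ N → (∀ i → 0# < y i) →
                     IsProjection ε y x → ∀ {j} → ε / fromℕ N < x j → ∀ k →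
                     x j * y k ≤ x k * y j
  projection-ratio {N} {ε} {x} {y} 0<a 0<y ((sum-x , a≤x) , x-min) {j} a<xj k =
    ≮⇒≥ λ lt → shift lt (small-step (diff⁺ a<xj) (diff⁺ lt) (0<y j ⊞ˡ <⇒≤ (0<y k)))
    where
    shift : x k * y j < x j * y k →
            (∃ λ s → 0# < s × s ≤ x j - ε / fromℕ N × s * (y j + y k) < x j * y k - x k * y j) → ⊥
    shift lt (s , 0<s , s≤ , s<) = <⇒≱ Fz<Fx (x-min z (sum-z , a≤z))
      where
      a : ℝ
      a = ε / fromℕ N

      z l : Fin N → ℝ
      z i = (x i + s * unit k i) + (- s) * unit j i
      l i = ln (z i / y i)

      0<x : ∀ i → 0# < x i
      0<x i = <-≤-trans 0<a (a≤x i)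

      sum-z : sum z ≈ 1#
      sum-z = begin
        sum z                                          ≈⟨ sum-+-* _ (- s) (unit j) ⟩
        sum (λ i → x i + s * unit k i) + - s * sum (unit j)
          ≈⟨ +-cong (sum-+-* x s (unit k)) (*-congˡ (sum-unit j)) ⟩
        (sum x + s * sum (unit k)) + - s * 1#
          ≈⟨ +-congʳ (+-cong sum-x (*-congˡ (sum-unit k))) ⟩
        (1# + s * 1#) + - s * 1#
          ≈⟨ solve 1 (λ s → num 1 :+ s :* num 1 :+ :- s :* num 1 := num 1) refl s ⟩
        1#                                             ∎
        where open SetoidReasoning setoid

      -- Only inequalities are claimed for the two moved coordinates, so the case k = j needs no
      -- separate argument.
      xj-s≤zj : x j - s ≤ z j
      xj-s≤zj = ≤-by (<⇒≤ 0<s ⊠ 0≤unit k j ⊞ <⇒≤ 0<s ⊠ diff (unit≤1 j j))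
        (solve 4 (λ x s e f → s :* e :+ s :* (num 1 :- f)
            := (x :+ s :* e) :+ (:- s) :* f :- (x :- s)) refl (x j) s (unit k j) (unit j j))

      zk≤xk+s : z k ≤ x k + s
      zk≤xk+s = ≤-by (<⇒≤ 0<s ⊠ diff (unit≤1 k k) ⊞ <⇒≤ 0<s ⊠ 0≤unit j k)
        (solve 4 (λ x s e f → s :* (num 1 :- e) :+ s :* f
            := x :+ s :- ((x :+ s :* e) :+ (:- s) :* f)) refl (x k) s (unit k k) (unit j k))

      a≤z : ∀ i → a ≤ z i
      a≤z i with j Fin.≟ i
      ... | yes ≡.refl = ≤-by (diff s≤ ⊞ <⇒≤ 0<s ⊠ 0≤unit k j)
        (solve 4 (λ x s a e → (x :- a :- s) :+ s :* e := (x :+ s :* e) :+ (:- s) :* num 1 :- a)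
          refl (x j) s a (unit k j))
      ... | no _ = ≤-by (diff (a≤x i) ⊞ <⇒≤ 0<s ⊠ 0≤unit k i)
        (solve 4 (λ x s a e → (x :- a) :+ s :* e := (x :+ s :* e) :+ (:- s) :* num 0 :- a)
          refl (x i) s a (unit k i))

      0<z : ∀ i → 0# < z i
      0<z i = <-≤-trans 0<a (a≤z i)

      lk<lj : l k < l j
      lk<lj = ln-mono-< (/-pos (0<z k) (0<y k)) (/-pos (0<z j) (0<y j))
        (/-mono-< (0<y k) (0<y j)
          (<-by (diff⁺ s< ⊞ˡ (diff zk≤xk+s ⊠ <⇒≤ (0<y j) ⊞ diff xj-s≤zj ⊠ <⇒≤ (0<y k)))
            (solve 7 (λ xj xk yj yk zj zk s →
                (xj :* yk :- xk :* yj :- s :* (yj :+ yk))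
                  :+ ((xk :+ s :- zk) :* yj :+ (zj :- (xj :- s)) :* yk)
                := zj :* yk :- zk :* yj)
              refl (x j) (x k) (y j) (y k) (z j) (z k) s)))

      d : (i : Fin N) → Fin N → ℝ
      d k i = unit k i * (l i + 1#)

      -- The tangent is taken at the new point z rather than at x, so the entropy changes by at most
      -- s (l k - l j), without a second-order term.
      term : ∀ i → z i * l i ≤ (x i * ln (x i / y i) + s * d k i) + (- s) * d j i
      term i = ≤-by (diff (ln-tangent (0<x i) (0<z i) (0<y i)))
        (solve 7 (λ z x l m s e f →
            ((x :+ s :* e) :+ (:- s) :* f :- x) :* (l :+ num 1) :- (z :* l :- x :* m)
            := (x :* m :+ s :* (e :* (l :+ num 1))) :+ (:- s) :* (f :* (l :+ num 1)) :- z :* l)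
          refl (z i) (x i) (l i) (ln (x i / y i)) s (unit k i) (unit j i))

      Fz<Fx : relativeEntropy z y < relativeEntropy x y
      Fz<Fx = ≤-<-trans (≤-trans (sum-mono term) (≤-reflexive (begin
          sum (λ i → (x i * ln (x i / y i) + s * d k i) + (- s) * d j i)
            ≈⟨ sum-+-* _ (- s) (d j) ⟩
          sum (λ i → x i * ln (x i / y i) + s * d k i) + (- s) * sum (d j)
            ≈⟨ +-cong (sum-+-* _ s (d k)) (*-congˡ (sum-unit-* j (λ i → l i + 1#))) ⟩
          (relativeEntropy x y + s * sum (d k)) + (- s) * (l j + 1#)
            ≈⟨ +-congʳ (+-congˡ (*-congˡ (sum-unit-* k (λ i → l i + 1#)))) ⟩
          (relativeEntropy x y + s * (l k + 1#)) + (- s) * (l j + 1#) ∎)))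
        (<-by (0<s ⊠⁺ diff⁺ lk<lj)
          (solve 4 (λ F s p q → s :* (q :- p)
              := F :- ((F :+ s :* (p :+ num 1)) :+ (:- s) :* (q :+ num 1)))
            refl (relativeEntropy x y) s (l k) (l j)))
        where open SetoidReasoning setoid

-- Queues and cumulative work

module Queues {c ℓ₁ ℓ₂} (R : RealNumbers c ℓ₁ ℓ₂) where
  open RealNumbers R hiding (zero)
  open Scheduling R
  open IntegerSolver R using (solve; _:=_; _:+_; _:*_; _:-_)
  open OrderedField R
  open Min totalOrder using (x⊓y≤x; x≤y⇒x⊓y≈x; x≤y⇒y⊓x≈x; ⊓-glb)
  open Max totalOrder using (x≤x⊔y; x≤y⇒x⊔y≈y; x≤y⇒y⊔x≈y)

  sumUpTo-suc : ∀ n f → sumUpTo (suc n) f ≈ sumUpTo n f + f (suc n)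
  sumUpTo-suc zero f = +-comm _ _
  sumUpTo-suc (suc n) f = trans (+-congˡ (sumUpTo-suc n (f ∘ suc))) (sym (+-assoc _ _ _))

  sumUpTo-mono : ∀ n {f g} → (∀ τ → 1 ℕ.≤ τ → τ ℕ.≤ n → f τ ≤ g τ) → sumUpTo n f ≤ sumUpTo n g
  sumUpTo-mono n p = sum-mono {n} λ k → p (suc (toℕ k)) (ℕ.s≤s ℕ.z≤n) (Fin.toℕ<n k)

  sumUpTo-extend : ∀ {m n f} → (∀ τ → 1 ℕ.≤ τ → τ ℕ.≤ n → 0# ≤ f τ) → m ℕ.≤ n →
                   sumUpTo m f ≤ sumUpTo n f
  sumUpTo-extend {m} {n} {f} 0≤f m≤n = extend n ℕ.≤-refl (ℕ.≤⇒≤′ m≤n)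
    where
    extend : ∀ k → k ℕ.≤ n → m ℕ.≤′ k → sumUpTo m f ≤ sumUpTo k f
    extend k k≤n (ℕ.≤′-reflexive ≡.refl) = ≤-refl
    extend (suc k) k<n (ℕ.≤′-step m≤k) = ≤-trans (extend k (ℕ.<⇒≤ k<n) m≤k)
      (≤-by (0≤f (suc k) (ℕ.s≤s ℕ.z≤n) k<n)
        (trans (solve 2 (λ s x → x := s :+ x :- s) refl (sumUpTo k f) (f (suc k)))
          (+-congʳ (sym (sumUpTo-suc k f)))))

  -- All terms up to m survive the cut at x, and whatever survives beyond m is nonnegative.
  sumUpTo≤sumUpToℝ : ∀ {m T x f} → (∀ τ → 1 ℕ.≤ τ → τ ℕ.≤ T → 0# ≤ f τ) →
                     m ℕ.≤ T → fromℕ m ≤ x → sumUpTo m f ≤ sumUpToℝ T x f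
  sumUpTo≤sumUpToℝ {m} {T} {x} {f} 0≤f m≤T m≤x = ≤-trans
    (sumUpTo-mono m {f} {cut} λ τ _ τ≤m →
      ≤-reflexive (sym (if-true (fromℕ τ ≤? x) (≤-trans (fromℕ-mono τ≤m) m≤x))))
    (sumUpTo-extend {f = cut} 0≤cut m≤T)
    where
    cut : ℕ → ℝ
    cut τ = if does (fromℕ τ ≤? x) then f τ else 0#

    0≤cut : ∀ τ → 1 ℕ.≤ τ → τ ℕ.≤ T → 0# ≤ cut τ
    0≤cut τ 1≤τ τ≤T with fromℕ τ ≤? x
    ... | yes _ = 0≤f τ 1≤τ τ≤T
    ... | no _  = ≤-refl

  x≤y⇒x-y≤0 : ∀ {x y} → x ≤ y → x - y ≤ 0#
  x≤y⇒x-y≤0 {x} {y} p = ≤-by (diff p) (solve 2 (λ x y → y :- x := num 0 :- (x :- y)) refl x y)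

  served+left : ∀ s l → min s l + max 0# (l - s) ≈ l
  served+left s l = [ enough , short ]′ (≤-total s l)
    where
    enough : s ≤ l → min s l + max 0# (l - s) ≈ l
    enough s≤l = trans (+-cong (x≤y⇒x⊓y≈x s≤l) (x≤y⇒x⊔y≈y (diff s≤l)))
      (solve 2 (λ s l → s :+ (l :- s) := l) refl s l)

    short : l ≤ s → min s l + max 0# (l - s) ≈ l
    short l≤s = trans (+-cong (x≤y⇒y⊓x≈x l≤s) (x≤y⇒y⊔x≈y (x≤y⇒x-y≤0 l≤s))) (+-identityʳ l)

  fully-used : ∀ {s l} → 0# < max 0# (l - s) → min s l ≈ s
  fully-used 0<left = x≤y⇒x⊓y≈x (≮⇒≥ λ l<s →
    <⇒≱ 0<left (≤-reflexive (x≤y⇒y⊔x≈y (x≤y⇒x-y≤0 (<⇒≤ l<s)))))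

  module _ {N : ℕ} (L h : Trajectory {N}) (i : Fin N) where
    W Load : ℕ → ℝ
    W n    = sumUpTo n (λ τ → work L h τ i)
    Load n = sumUpTo n (λ τ → L τ i)

    W-suc : ∀ n → W (suc n) ≈ W n + work L h (suc n) i
    W-suc n = sumUpTo-suc n (λ τ → work L h τ i)

    0≤queue : ∀ n → 0# ≤ queue L h n i
    0≤queue zero          = ≤-refl
    0≤queue (suc zero)    = ≤-refl
    0≤queue (suc (suc n)) = x≤x⊔y 0# _

    work≤allocation : ∀ n → work L h n i ≤ h n i
    work≤allocation n = x⊓y≤x (h n i) _

    0≤work : ∀ n → 0# ≤ h n i → 0# ≤ L n i → 0# ≤ work L h n i
    0≤work n 0≤h 0≤L = ⊓-glb 0≤h (0≤L ⊞ 0≤queue n)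

    conservation : ∀ n → W n + queue L h (suc n) i ≈ Load n
    conservation zero = +-identityʳ 0#
    conservation (suc n) = begin
      W (suc n) + Q′                ≈⟨ +-congʳ (W-suc n) ⟩
      W n + w + Q′                  ≈⟨ +-assoc _ _ _ ⟩
      W n + (w + Q′)                ≈⟨ +-congˡ (served+left (h (suc n) i) _) ⟩
      W n + (L (suc n) i + Q)       ≈⟨ solve 3 (λ W l q → W :+ (l :+ q) := W :+ q :+ l) refl (W n) (L (suc n) i) Q ⟩
      W n + Q + L (suc n) i         ≈⟨ +-congʳ (conservation n) ⟩
      Load n + L (suc n) i          ≈⟨ sumUpTo-suc n (λ τ → L τ i) ⟨
      Load (suc n)                  ∎
      where
      open SetoidReasoning setoid
      w Q Q′ : ℝ
      w  = work L h (suc n) i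
      Q  = queue L h (suc n) i
      Q′ = queue L h (suc (suc n)) i

    W≤Load : ∀ n → W n ≤ Load n
    W≤Load n = ≤-by (0≤queue (suc n))
      (trans (solve 2 (λ W q → q := W :+ q :- W) refl (W n) (queue L h (suc n) i)) (+-congʳ (conservation n)))

    Load≤W : ∀ n → ¬ Active (queue L h (suc n)) i → Load n ≤ W n
    Load≤W n idle = ≤-by (diff (≮⇒≥ idle))
      (trans (solve 2 (λ W q → num 0 :- q := W :- (W :+ q)) refl (W n) (queue L h (suc n) i))
        (+-congˡ (-‿cong (conservation n))))

    -- The busy period containing time n + 1; the last idle time before it is s + 1.
    last-idle : ∀ n → ∃₂ λ s u → n ≡ u ℕ.+ s × ¬ Active (queue L h (suc s)) i ×
                (∀ k → k ℕ.< u → Active (queue L h (suc (suc (k ℕ.+ s)))) i)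
    last-idle zero = 0 , 0 , ≡.refl , (λ 0<0 → proj₂ 0<0 refl) , λ _ ()
    last-idle (suc n) with active? (queue L h (suc (suc n))) i
    ... | no idle = suc n , 0 , ≡.refl , idle , λ _ ()
    ... | yes act with last-idle n
    ...   | s , u , ≡.refl , idle , busy = s , suc u , ≡.refl , idle , busy′
      where
      busy′ : ∀ k → k ℕ.< suc u → Active (queue L h (suc (suc (k ℕ.+ s)))) i
      busy′ k (ℕ.s≤s k≤u) with ℕ.m≤n⇒m<n∨m≡n k≤u
      ... | inj₁ k<u    = busy k k<u
      ... | inj₂ ≡.refl = act

    W-linear-bound : ∀ s k {r} → (∀ τ → 1 ℕ.≤ τ → τ ℕ.≤ k ℕ.+ s → h τ i ≤ r) →
                     W (k ℕ.+ s) ≤ Load s + fromℕ k * r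
    W-linear-bound s zero {r} _ = ≤-respʳ-≈
      (solve 2 (λ l r → l := l :+ num 0 :* r) refl (Load s) r) (W≤Load s)
    W-linear-bound s (suc k) {r} h≤r = ≤-by
      (diff (W-linear-bound s k (λ τ 1≤τ τ≤ → h≤r τ 1≤τ (ℕ.m≤n⇒m≤1+n τ≤)))
        ⊞ diff (≤-trans (work≤allocation (suc (k ℕ.+ s))) (h≤r _ (ℕ.s≤s ℕ.z≤n) ℕ.≤-refl)))
      (trans (solve 5 (λ W w l k r → (l :+ k :* r :- W) :+ (r :- w)
                := l :+ (num 1 :+ k) :* r :- (W :+ w)) refl (W (k ℕ.+ s)) _ (Load s) (fromℕ k) r)
        (+-congˡ (-‿cong (sym (W-suc (k ℕ.+ s))))))

module Algorithm2 {c ℓ₁ ℓ₂} (R : RealNumbers c ℓ₁ ℓ₂) where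
  open RealNumbers R hiding (zero)
  open Scheduling R
  open IntegerSolver R using (solve; _:=_; _:+_; _:*_; _:-_; :-_)
  open OrderedField R
  open Projection R
  open Queues R
  open Mult semiring using (×-homo-+)

  -- The constants and their numerical relations

  module Constants
    (N : ℕ) (1≤N : 1 ℕ.≤ N)
    (ε η : ℝ)
    (0<ε : 0# < ε) (ε≤1/10 : ε ≤ 1# / fromℕ 10)
    (0<η : 0# < η) (η≤1/3 : η ≤ 1# / fromℕ 3) where

    -- `u` is the exponent by which a user in A¹ is favoured over one in A², and `u * a` is the mass
    -- at stake on one coordinate. Halving it in `δ` leaves the strict gap that the contradictions
    -- need.
    n a λ₀ u δ : ℝ
    n  = fromℕ N
    a  = ε / n
    λ₀ = λ′ N ε
    u  = η * λ₀
    δ  = (u * a) / fromℕ 2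

    private
      x≤1/m : ∀ m {x} → x ≤ 1# / fromℕ (suc m) → x * fromℕ (suc m) ≤ 1#
      x≤1/m m p = ≤-respʳ-≈ (x/y*y≈x 1# (0<fromℕ m)) (*-monoʳ-≤ (0≤fromℕ (suc m)) p)

    10ε≤1 : ε * fromℕ 10 ≤ 1#
    10ε≤1 = x≤1/m 9 ε≤1/10

    3η≤1 : η * fromℕ 3 ≤ 1#
    3η≤1 = x≤1/m 2 η≤1/3

    ε≤1 : ε ≤ 1#
    ε≤1 = ≤-by (diff 10ε≤1 ⊞ 0≤fromℕ 9 ⊠ <⇒≤ 0<ε)
      (solve 1 (λ e → num 1 :- e :* num 10 :+ num 9 :* e := num 1 :- e) refl ε)

    η≤1 : η ≤ 1#
    η≤1 = ≤-by (diff 3η≤1 ⊞ 0≤fromℕ 2 ⊠ <⇒≤ 0<η)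
      (solve 1 (λ e → num 1 :- e :* num 3 :+ num 2 :* e := num 1 :- e) refl η)

    1≤n : 1# ≤ n
    1≤n = ≤-respˡ-≈ (+-identityʳ 1#) (fromℕ-mono 1≤N)

    0<n : 0# < n
    0<n = <-≤-trans 0<1 1≤n

    an≈ε : a * n ≈ ε
    an≈ε = x/y*y≈x ε 0<n

    0<a : 0# < a
    0<a = /-pos 0<ε 0<n

    a≤ε : a ≤ ε
    a≤ε = ≤-by (<⇒≤ 0<a ⊠ diff 1≤n)
      (trans (solve 2 (λ a n → a :* (n :- num 1) := a :* n :- a) refl a n) (+-congʳ an≈ε))

    a≤1 : a ≤ 1#
    a≤1 = ≤-trans a≤ε ε≤1

    0<8n : 0# < fromℕ 8 * n
    0<8n = 0<fromℕ 7 ⊠⁺ 0<n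

    λ8n≈ε² : λ₀ * (fromℕ 8 * n) ≈ ε ^ 2
    λ8n≈ε² = x/y*y≈x (ε ^ 2) 0<8n

    0<λ : 0# < λ₀
    0<λ = /-pos (0<ε ⊠⁺ (0<ε ⊠⁺ 0<1)) 0<8n

    8λ≤ε : fromℕ 8 * λ₀ ≤ ε
    8λ≤ε = ≤-by (0≤fromℕ 8 ⊠ <⇒≤ 0<λ ⊠ diff 1≤n ⊞ <⇒≤ 0<ε ⊠ diff ε≤1)
      (trans (solve 3 (λ l n e → num 8 :* l :* (n :- num 1) :+ e :* (num 1 :- e)
                := l :* (num 8 :* n) :+ (e :- e :* e :- num 8 :* l)) refl λ₀ n ε)
      (trans (+-congʳ λ8n≈ε²)
        (solve 2 (λ l e → e :* (e :* num 1) :+ (e :- e :* e :- num 8 :* l) := e :- num 8 :* l) refl λ₀ ε)))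

    0<u : 0# < u
    0<u = 0<η ⊠⁺ 0<λ

    8u≤εη : fromℕ 8 * u ≤ ε * η
    8u≤εη = ≤-by (<⇒≤ 0<η ⊠ diff 8λ≤ε)
      (solve 3 (λ h l e → h :* (e :- num 8 :* l) := e :* h :- num 8 :* (h :* l)) refl η λ₀ ε)

    4u≤η : fromℕ 4 * u ≤ η
    4u≤η = ≤-by (diff 8u≤εη ⊞ 0≤fromℕ 4 ⊠ <⇒≤ 0<u ⊞ <⇒≤ 0<η ⊠ diff ε≤1)
      (solve 3 (λ u e h → e :* h :- num 8 :* u :+ num 4 :* u :+ h :* (num 1 :- e)
         := h :- num 4 :* u) refl u ε η)

    u≤ε : u ≤ ε
    u≤ε = ≤-by (diff 8u≤εη ⊞ 0≤fromℕ 7 ⊠ <⇒≤ 0<u ⊞ <⇒≤ 0<ε ⊠ diff η≤1)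
      (solve 3 (λ u e h → e :* h :- num 8 :* u :+ num 7 :* u :+ e :* (num 1 :- h)
         := e :- u) refl u ε η)

    4u≤1 : fromℕ 4 * u ≤ 1#
    4u≤1 = ≤-trans 4u≤η η≤1

    u≤1 : u ≤ 1#
    u≤1 = ≤-trans u≤ε ε≤1

    2δ≈ua : δ * fromℕ 2 ≈ u * a
    2δ≈ua = x/y*y≈x (u * a) (0<fromℕ 1)

    0<δ : 0# < δ
    0<δ = /-pos (0<u ⊠⁺ 0<a) (0<fromℕ 1)

    δ≤u : δ ≤ u
    δ≤u = ≤-by (<⇒≤ 0<δ ⊞ <⇒≤ 0<u ⊠ diff a≤1)
      (trans (solve 3 (λ d u a → d :+ u :* (num 1 :- a) := (u :- d) :+ (d :* num 2 :- u :* a)) refl δ u a)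
      (trans (+-congˡ (+-congʳ 2δ≈ua))
         (solve 3 (λ d u a → u :- d :+ (u :* a :- u :* a) := u :- d) refl δ u a)))

    10a≤1 : a * fromℕ 10 ≤ 1#
    10a≤1 = ≤-trans (*-monoʳ-≤ (0≤fromℕ 10) a≤ε) 10ε≤1

    80δ≤1 : δ * fromℕ 80 ≤ 1#
    80δ≤1 = ≤-by (diff 10a≤1 ⊞ 0≤fromℕ 10 ⊠ <⇒≤ 0<a ⊠ diff 4u≤1)
      (trans (solve 2 (λ a u → num 1 :- a :* num 10 :+ num 10 :* a :* (num 1 :- num 4 :* u)
         := num 1 :- num 40 :* (u :* a)) refl a u)
      (trans (+-congˡ (-‿cong (*-congˡ (sym 2δ≈ua))))
        (solve 1 (λ d → num 1 :- num 40 :* (d :* num 2) := num 1 :- d :* num 80) refl δ)))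

    E : ℝ
    E = exp (η * (1# + λ₀))

    1+η+u≤E : 1# + (η + u) ≤ E
    1+η+u≤E = ≤-respˡ-≈
      (solve 2 (λ h l → num 1 :+ h :* (num 1 :+ l) := num 1 :+ (h :+ h :* l)) refl η λ₀) (1+x≤exp _)

    -- The product (1 - u) (1 + η + u) is 1 + η - u η - u². Here η ≥ 4 u covers u η, u² and δ, each
    -- of which is at most u. It is used for idle users, whose factor is 1 instead of `E`.
    1+δ≤[1-u]E : 1# + δ ≤ (1# - u) * E
    1+δ≤[1-u]E = ≤-trans
      (≤-by (diff 4u≤η ⊞ <⇒≤ 0<u ⊠ diff η≤1 ⊞ <⇒≤ 0<u ⊠ diff u≤1 ⊞ diff δ≤u ⊞ <⇒≤ 0<u)
        (solve 3 (λ u h d → h :- num 4 :* u :+ u :* (num 1 :- h) :+ u :* (num 1 :- u) :+ (u :- d) :+ u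
          := (num 1 :- u) :* (num 1 :+ (h :+ u)) :- (num 1 :+ d)) refl u η δ))
      (≤-by (diff u≤1 ⊠ diff 1+η+u≤E)
        (solve 3 (λ u x e → (num 1 :- u) :* (e :- x) := (num 1 :- u) :* e :- (num 1 :- u) :* x) refl u _ E))

    -- The origin of 2 ε in the comparison: one unfavourable step from the level (1 - ε) share costs
    -- at most another ε, since u ≤ ε.
    [1-2ε]≤exp[-u][1-ε] : 1# - fromℕ 2 * ε ≤ exp (- u) * (1# - ε)
    [1-2ε]≤exp[-u][1-ε] = ≤-by (diff (1+x≤exp (- u)) ⊠ diff ε≤1 ⊞ diff u≤ε ⊞ <⇒≤ 0<u ⊠ <⇒≤ 0<ε)
      (solve 3 (λ u e x → (x :- (num 1 :+ :- u)) :* (num 1 :- e) :+ (e :- u) :+ u :* e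
         := x :* (num 1 :- e) :- (num 1 :- num 2 :* e)) refl u ε (exp (- u)))

    -- The origin of 32: δ is η ε³ / (16 N²), and p̃ is twice ln (N / ε) / δ. The factor two pays
    -- for the difference between ln (1 + δ) and δ, for rounding p̃, and for the steps lost around a
    -- busy period.
    p̃δ≈2ln : p̃ N ε η * δ ≈ fromℕ 2 * ln (n / ε)
    p̃δ≈2ln = trans (solve 3 (λ q l d → (num 32 :* q) :* l :* d := (num 32 :* (q :* d)) :* l) refl q _ δ)
        (*-congʳ (*-cancelʳ-≈ 0<n² eq))
      where
      open SetoidReasoning setoid
      q : ℝ
      q = (n ^ 2) / ((ε ^ 3) * η)

      0<n² : 0# < n ^ 2
      0<n² = 0<n ⊠⁺ (0<n ⊠⁺ 0<1)

      eq : fromℕ 32 * (q * δ) * n ^ 2 ≈ fromℕ 2 * n ^ 2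
      eq = begin
        fromℕ 32 * (q * δ) * n ^ 2
          ≈⟨ solve 3 (λ q d n → num 32 :* (q :* d) :* (n :* (n :* num 1))
               := num 16 :* q :* (n :* n) :* (d :* num 2)) refl q δ n ⟩
        fromℕ 16 * q * (n * n) * (δ * fromℕ 2)           ≈⟨ *-congˡ 2δ≈ua ⟩
        fromℕ 16 * q * (n * n) * (u * a)
          ≈⟨ solve 5 (λ q n h l a → num 16 :* q :* (n :* n) :* (h :* l :* a)
               := num 2 :* q :* h :* (l :* (num 8 :* n)) :* (a :* n)) refl q n η λ₀ a ⟩
        fromℕ 2 * q * η * (λ₀ * (fromℕ 8 * n)) * (a * n)  ≈⟨ *-cong (*-congˡ λ8n≈ε²) an≈ε ⟩
        fromℕ 2 * q * η * ε ^ 2 * ε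
          ≈⟨ solve 3 (λ q h e → num 2 :* q :* h :* (e :* (e :* num 1)) :* e
               := num 2 :* (q :* ((e :* (e :* (e :* num 1))) :* h))) refl q η ε ⟩
        fromℕ 2 * (q * (ε ^ 3 * η))
          ≈⟨ *-congˡ (x/y*y≈x (n ^ 2) ((0<ε ⊠⁺ (0<ε ⊠⁺ (0<ε ⊠⁺ 0<1))) ⊠⁺ 0<η)) ⟩
        fromℕ 2 * n ^ 2 ∎

    0<n/ε : 0# < n / ε
    0<n/ε = /-pos 0<n 0<ε

    a*n/ε≈1 : a * (n / ε) ≈ 1#
    a*n/ε≈1 = trans (solve 3 (λ a n r → a :* (n :* r) := a :* n :* r) refl a n (ε ⁻¹))
      (trans (*-congʳ an≈ε) (⁻¹-inverse 0<ε))

    -- A crude bound from ln (n / ε) ≥ 1 - a ≥ 9/10 and δ ≤ 1/80. It makes the lost steps negligible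
    -- against p̃.
    16≤p̃ : fromℕ 16 ≤ p̃ N ε η
    16≤p̃ = *-cancelʳ-≤ 0<δ (≤-respʳ-≈ (sym p̃δ≈2ln)
      (≤-by (diff 80δ≤1 ⊞ 0≤fromℕ 64 ⊠ <⇒≤ 0<δ ⊞ diff 10a≤1 ⊞ 0≤fromℕ 8 ⊠ <⇒≤ 0<a
             ⊞ 0≤fromℕ 2 ⊠ diff (1-x⁻¹≤ln 0<n/ε a*n/ε≈1))
        (solve 3 (λ d a l → (num 1 :- d :* num 80) :+ num 64 :* d :+ (num 1 :- a :* num 10) :+ num 8 :* a
             :+ num 2 :* (l :- (num 1 :- a))
           := num 2 :* l :- num 16 :* d) refl δ a (ln (n / ε)))))

  module Guarantee
    (N : ℕ) (1≤N : 1 ℕ.≤ N)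
    (ε η : ℝ)
    (0<ε : 0# < ε) (ε≤1/10 : ε ≤ 1# / fromℕ 10)
    (0<η : 0# < η) (η≤1/3 : η ≤ 1# / fromℕ 3)
    (β : Fin N → ℝ) (0≤β : ∀ i → 0# ≤ β i) (0<Σβ : 0# < sum β)
    (large-share : ∀ i → (exp (η * (1# + λ′ N ε)) / (1# - ε)) * (ε / fromℕ N) ≤ share β i)
    where
    open Constants N 1≤N ε η 0<ε ε≤1/10 0<η η≤1/3

    0<1-ε : 0# < 1# - ε
    0<1-ε = <-≤-trans (0<fromℕ 8 ⊠⁺ 0<ε) (≤-by (diff 10ε≤1)
      (solve 1 (λ e → num 1 :- e :* num 10 := num 1 :- e :- num 9 :* e) refl ε))

    0<E : 0# < E
    0<E = exp-pos _

    -- The SLA hypothesis in the form used: the thresholds lie at least a factor `E` above the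
    -- floor.
    aE≤[1-ε]share : ∀ i → a * E ≤ (1# - ε) * share β i
    aE≤[1-ε]share i = ≤-respˡ-≈
      (trans (solve 4 (λ E r a s → E :* r :* a :* s := E :* (s :* r) :* a) refl E ((1# - ε) ⁻¹) a (1# - ε))
        (trans (*-congʳ (trans (*-congˡ (⁻¹-inverse 0<1-ε)) (*-identityʳ E))) (*-comm E a)))
      (≤-respʳ-≈ (*-comm _ _) (*-monoʳ-≤ (<⇒≤ 0<1-ε) (large-share i)))

    0<share : ∀ i → 0# < share β i
    0<share i = <-≤-trans (/-pos 0<E 0<1-ε ⊠⁺ 0<a) (large-share i)

    share*Σβ≈β : ∀ i → share β i * sum β ≈ β i
    share*Σβ≈β i = x/y*y≈x (β i) 0<Σβ

    0<β : ∀ i → 0# < β i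
    0<β i = <-respʳ-≈ (share*Σβ≈β i) (0<share i ⊠⁺ 0<Σβ)

    share≤1 : ∀ i → share β i ≤ 1#
    share≤1 i = *-cancelʳ-≤ 0<Σβ
      (≤-respˡ-≈ (sym (share*Σβ≈β i)) (≤-respʳ-≈ (sym (*-identityˡ _)) (sum-single 0≤β i)))

    -- A single update of the allocation

    module Step (Q h x : Fin N → ℝ) (h∈Δ : TruncatedSimplex ε h)
                (proj : IsProjection ε (multiplicativeUpdate ε η β Q h) x) where

      activeβ : Fin N → ℝ
      activeβ j = if does (active? Q j) then β j else 0#

      B : ℝ
      B = activeSum Q β

      thr g G y : Fin N → ℝ
      thr j = (1# - ε) * (β j / B)
      g j   = gain ε β Q h j
      G j   = exp (η * g j)
      y j   = h j * G j

      a≤h : ∀ j → a ≤ h j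
      a≤h = proj₂ h∈Δ

      a≤x : ∀ j → a ≤ x j
      a≤x = proj₂ (proj₁ proj)

      0<h : ∀ j → 0# < h j
      0<h j = <-≤-trans 0<a (a≤h j)

      0<G : ∀ j → 0# < G j
      0<G j = exp-pos _

      0<y : ∀ j → 0# < y j
      0<y j = 0<h j ⊠⁺ 0<G j

      -- The sets A¹, A² and B of the algorithm.
      data Class (j : Fin N) : Set (c ⊔ ℓ₁ ⊔ ℓ₂) where
        below : Active Q j → h j < thr j → g j ≈ 1# + λ₀ → Class j
        above : Active Q j → ¬ h j < thr j → g j ≈ 1# → Class j
        idle  : ¬ Active Q j → g j ≈ 0# → Class j

      classify : ∀ j → Class j
      classify j = by-cases (active? Q j) (h j <? thr j)
        where
        by-cases : Dec (Active Q j) → Dec (h j < thr j) → Class j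
        by-cases (yes p) (yes q) = below p q (trans (if-true (active? Q j) p) (if-true (h j <? thr j) q))
        by-cases (yes p) (no q)  = above p q (trans (if-true (active? Q j) p) (if-false (h j <? thr j) q))
        by-cases (no p)  _       = idle p (if-false (active? Q j) p)

      active-β : ∀ {j} → Active Q j → activeβ j ≈ β j
      active-β {j} p = if-true (active? Q j) p

      idle-β : ∀ {j} → ¬ Active Q j → activeβ j ≈ 0#
      idle-β {j} ¬p = if-false (active? Q j) ¬p

      0≤activeβ : ∀ j → 0# ≤ activeβ j
      0≤activeβ j with active? Q j
      ... | yes p = ≤-respʳ-≈ (sym (active-β p)) (0≤β j)
      ... | no ¬p = ≤-reflexive (sym (idle-β ¬p))

      activeβ≤β : ∀ j → activeβ j ≤ β j
      activeβ≤β j with active? Q j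
      ... | yes p = ≤-reflexive (active-β p)
      ... | no ¬p = ≤-respˡ-≈ (sym (idle-β ¬p)) (0≤β j)

      0<B : ∀ {i} → Active Q i → 0# < B
      0<B {i} p = <-≤-trans (0<β i) (≤-respˡ-≈ (active-β p) (sum-single 0≤activeβ i))

      share≤β/B : ∀ {i} → Active Q i → ∀ k → share β k ≤ β k / B
      share≤β/B p k = *-cancelʳ-≤ 0<Σβ
        (≤-respˡ-≈ (trans (x/y*y≈x (β k) (0<B p)) (sym (share*Σβ≈β k)))
          (≤-by ((0≤β k ⊠ <⇒≤ (⁻¹-pos (0<B p))) ⊠ diff (sum-mono activeβ≤β))
            (solve 3 (λ r S B → r :* (S :- B) := r :* S :- r :* B) refl (β k / B) (sum β) B)))

      -- The active SLAs sum to at most the total, so the moving threshold never drops below a level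
      -- that does not depend on who is active.
      share≤thr : ∀ {i} → Active Q i → ∀ k → (1# - ε) * share β k ≤ thr k
      share≤thr p k = ≤-by (<⇒≤ 0<1-ε ⊠ diff (share≤β/B p k))
        (solve 3 (λ e r s → e :* (r :- s) := e :* r :- e :* s) refl (1# - ε) (β k / B) (share β k))

      G-cong : ∀ {j v} → g j ≈ v → G j ≈ exp (η * v)
      G-cong eq = exp-cong (*-congˡ eq)

      1≤G : ∀ j → 1# ≤ G j
      1≤G j = ≤-trans (≤-by (<⇒≤ 0<η ⊠ 0≤g (classify j))
          (solve 1 (λ x → x := num 1 :+ x :- num 1) refl (η * g j))) (1+x≤exp _)
        where
        0≤g : Class j → 0# ≤ g j
        0≤g (below _ _ eq) = ≤-respʳ-≈ (sym eq) (0≤1 ⊞ <⇒≤ 0<λ)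
        0≤g (above _ _ eq) = ≤-respʳ-≈ (sym eq) 0≤1
        0≤g (idle _ eq)    = ≤-reflexive (sym eq)

      G≤E : ∀ j → G j ≤ E
      G≤E j = exp-mono (≤-by (<⇒≤ 0<η ⊠ diff (g≤ (classify j)))
          (solve 3 (λ h g v → h :* (v :- g) := h :* v :- h :* g) refl η (g j) (1# + λ₀)))
        where
        g≤ : Class j → g j ≤ 1# + λ₀
        g≤ (below _ _ eq) = ≤-reflexive eq
        g≤ (above _ _ eq) = ≤-by (<⇒≤ 0<λ)
          (trans (solve 1 (λ l → l := num 1 :+ l :- num 1) refl λ₀) (+-congˡ (-‿cong (sym eq))))
        g≤ (idle _ eq)    = ≤-by (0≤1 ⊞ <⇒≤ 0<λ)
          (trans (solve 1 (λ l → num 1 :+ l := num 1 :+ l :- num 0) refl λ₀) (+-congˡ (-‿cong (sym eq))))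

      -- If the projection rescales y i by at most κ / E, it does so for every
      -- coordinate that it does not put on the floor a.
      dominated : ∀ {κ i} → x i * E ≤ κ * y i → ∀ j → x j ≤ a ⊎ x j * E ≤ κ * y j
      dominated {κ} {i} xiE≤κyi j with a <? x j
      ... | no a≮xj  = inj₁ (≮⇒≥ a≮xj)
      ... | yes a<xj = inj₂ (*-cancelʳ-≤ (0<y i)
        (≤-by (<⇒≤ 0<E ⊠ diff (projection-ratio 0<a 0<y proj a<xj i) ⊞ <⇒≤ (0<y j) ⊠ diff xiE≤κyi)
          (solve 6 (λ E κ xi xj yi yj →
              E :* (xi :* yj :- xj :* yi) :+ yj :* (κ :* yi :- xi :* E)
              := κ :* yj :* yi :- xj :* E :* yi) refl E κ (x i) (x j) (y i) (y j))))

      -- A coordinate on the floor cannot have grown; any other gains at most `E` and is then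
      -- rescaled by at most κ / `E`.
      bounded : ∀ {κ i} → 1# ≤ κ → x i * E ≤ κ * y i → ∀ j → x j ≤ κ * h j
      bounded {κ} {i} 1≤κ p j with dominated p j
      ... | inj₁ xj≤a = ≤-trans xj≤a (≤-by (diff (a≤h j) ⊞ diff 1≤κ ⊠ <⇒≤ (0<h j))
        (solve 3 (λ a h k → h :- a :+ (k :- num 1) :* h := k :* h :- a) refl a (h j) κ))
      ... | inj₂ xjE≤ = *-cancelʳ-≤ 0<E
        (≤-by (diff xjE≤ ⊞ (0≤κ ⊠ <⇒≤ (0<h j)) ⊠ diff (G≤E j))
          (solve 5 (λ x E k h G → (k :* (h :* G) :- x :* E) :+ k :* h :* (E :- G)
             := k :* h :* E :- x :* E) refl (x j) E κ (h j) (G j)))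
        where
        0≤κ : 0# ≤ κ
        0≤κ = ≤-trans 0≤1 1≤κ

      -- Lowering the cap f by w at i alone would push the sum of x below 1.
      no-gap : ∀ {f : Fin N → ℝ} {w} → sum f < 1# + w → (∀ j → x j ≤ f j) → ∀ i → x i ≤ f i - w → ⊥
      no-gap {f} {w} Σf<1+w x≤f i xi≤ = <⇒≱ Σf<1+w
        (≤-by (diff (sum-mono x≤f-w)) (trans (+-cong (sum-+-* f (- w) (unit i)) (-‿cong (proj₁ (proj₁ proj))))
          (trans (+-congʳ (+-congˡ (*-congˡ (sum-unit i))))
            (solve 2 (λ s w → s :+ :- w :* num 1 :- num 1 := s :- (num 1 :+ w)) refl (sum f) w))))
        where
        x≤f-w : ∀ j → x j ≤ f j + - w * unit i j
        x≤f-w j with i Fin.≟ j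
        ... | yes ≡.refl = ≤-respʳ-≈ (+-congˡ (sym (*-identityʳ (- w)))) xi≤
        ... | no _ = ≤-respʳ-≈ (trans (sym (+-identityʳ _)) (+-congˡ (sym (zeroʳ (- w))))) (x≤f j)

      -- Otherwise `bounded` with κ = 1 lets no coordinate grow, while coordinate i strictly
      -- shrinks, although both sums are 1.
      y≤xE : ∀ i → y i ≤ x i * E
      y≤xE i = ≮⇒≥ λ lt →
        no-gap {f = h} {w = h i - x i}
          (<-by (diff⁺ (xi<hi lt))
            (trans (solve 1 (λ w → w := num 1 :+ w :- num 1) refl (h i - x i))
              (+-congˡ (-‿cong (sym (proj₁ h∈Δ))))))
          (λ j → ≤-respʳ-≈ (*-identityˡ (h j))
            (bounded ≤-refl (≤-respʳ-≈ (sym (*-identityˡ (y i))) (<⇒≤ lt)) j))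
          i (≤-reflexive (solve 2 (λ x h → x := h :- (h :- x)) refl (x i) (h i)))
        where
        xi<hi : x i * E < y i → x i < h i
        xi<hi lt = ≰⇒> λ hi≤xi → <⇒≱ lt
          (≤-by (diff hi≤xi ⊠ <⇒≤ 0<E ⊞ <⇒≤ (0<h i) ⊠ diff (G≤E i))
            (solve 4 (λ x h E G → (x :- h) :* E :+ h :* (E :- G) := x :* E :- h :* G)
              refl (x i) (h i) E (G i)))

      growth : ∀ {i} → Active Q i → h i < thr i → h i * (1# + δ) ≤ x i
      growth {i} act low = ≮⇒≥ λ lt → cases lt (Fin.any? (λ k → active? Q k ×-dec ¬? (h k <? thr k)))
        where
        κ : ℝ
        κ = 1# + δ

        1≤κ : 1# ≤ κ
        1≤κ = ≤-by (<⇒≤ 0<δ) (solve 1 (λ d → d := num 1 :+ d :- num 1) refl δ)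

        0≤κ : 0# ≤ κ
        0≤κ = ≤-trans 0≤1 1≤κ

        Gi≈E : Class i → G i ≈ E
        Gi≈E (below _ _ eq)   = G-cong eq
        Gi≈E (above _ hi≥ _)  = contradiction low hi≥
        Gi≈E (idle ¬act _)    = contradiction act ¬act

        module _ (lt : x i < h i * κ) where
          xiE≤κyi : x i * E ≤ κ * y i
          xiE≤κyi = ≤-respʳ-≈
            (trans (solve 3 (λ h k E → h :* k :* E := k :* (h :* E)) refl (h i) κ E)
              (*-congˡ (*-congˡ (sym (Gi≈E (classify i))))))
            (*-monoʳ-≤ (<⇒≤ 0<E) (<⇒≤ lt))

          module Above {k} (actₖ : Active Q k) (¬lowₖ : ¬ h k < thr k) where
            Gk≈expη : Class k → G k ≈ exp η
            Gk≈expη (below _ lowₖ _) = contradiction lowₖ ¬lowₖ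
            Gk≈expη (above _ _ eq)   = trans (G-cong eq) (exp-cong (*-identityʳ η))
            Gk≈expη (idle ¬act _)    = contradiction actₖ ¬act

            G[1+u]≤E : G k * (1# + u) ≤ E
            G[1+u]≤E = ≤-respˡ-≈
              (*-cong (sym (Gk≈expη (classify k)))
                (solve 2 (λ h l → num 1 :+ (h :* (num 1 :+ l) :- h) := num 1 :+ h :* l) refl η λ₀))
              (exp-tangent η (η * (1# + λ₀)))

            aE≤hk : a * E ≤ h k
            aE≤hk = ≤-trans (aE≤[1-ε]share k) (≤-trans (share≤thr actₖ k) (≮⇒≥ ¬lowₖ))

            -- On the floor, `x k * E` is at most `a * E`, which `h k` already exceeds or equals; so
            -- both outcomes of `dominated` give the same bound.
            xkE≤κyk : x k * E ≤ κ * y k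
            xkE≤κyk = [ (λ xk≤a → ≤-by
                (diff xk≤a ⊠ <⇒≤ 0<E ⊞ diff aE≤hk ⊞ <⇒≤ (0<h k) ⊠ diff (1≤G k) ⊞ diff 1≤κ ⊠ <⇒≤ (0<y k))
                (solve 6 (λ x a E h G k → (a :- x) :* E :+ (h :- a :* E) :+ h :* (G :- num 1)
                     :+ (k :- num 1) :* (h :* G) := k :* (h :* G) :- x :* E)
                  refl (x k) a E (h k) (G k) κ))
              , (λ p → p) ]′ (dominated xiE≤κyi k)

            xk[1+u]≤κhk : x k * (1# + u) ≤ κ * h k
            xk[1+u]≤κhk = *-cancelʳ-≤ (0<G k)
              (≤-by (diff xkE≤κyk ⊞ <⇒≤ (<-≤-trans 0<a (a≤x k)) ⊠ diff G[1+u]≤E)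
                (solve 6 (λ x u G E k h → (k :* (h :* G) :- x :* E) :+ x :* (E :- G :* (num 1 :+ u))
                    := k :* h :* G :- x :* (num 1 :+ u) :* G) refl (x k) u (G k) E κ (h k)))

            impossible : ⊥
            -- These caps exceed 1 by δ in total, whereas coordinate k lies u x k ≥ u a = 2 δ below
            -- its own.
            impossible = no-gap {f = λ j → h j + δ * h j} {w = u * a}
              (<-by 0<δ (begin
                δ                       ≈⟨ solve 1 (λ d → d := d :* num 2 :- d) refl δ ⟩
                δ * fromℕ 2 - δ         ≈⟨ +-congʳ 2δ≈ua ⟩
                u * a - δ               ≈⟨ solve 2 (λ w d → w :- d := num 1 :+ w :- (num 1 :+ d :* num 1)) refl (u * a) δ ⟩
                1# + u * a - (1# + δ * 1#)
                  ≈⟨ +-congˡ (-‿cong (trans (sum-+-* h δ h) (+-cong (proj₁ h∈Δ) (*-congˡ (proj₁ h∈Δ))))) ⟨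
                1# + u * a - sum (λ j → h j + δ * h j) ∎))
              (λ j → ≤-respʳ-≈ (solve 2 (λ d h → (num 1 :+ d) :* h := h :+ d :* h) refl δ (h j))
                (bounded 1≤κ xiE≤κyi j))
              k (≤-by (diff xk[1+u]≤κhk ⊞ <⇒≤ 0<u ⊠ diff (a≤x k))
                (solve 5 (λ x u a d h → ((num 1 :+ d) :* h :- x :* (num 1 :+ u)) :+ u :* (x :- a)
                  := h :+ d :* h :- u :* a :- x) refl (x k) u a δ (h k)))
              where open SetoidReasoning setoid

          module AllBelow (none : ¬ ∃ λ k → Active Q k × ¬ h k < thr k) where
            K : ℝ
            K = ((δ + u) * (1# - ε)) / B

            -- One formula caps active and idle users alike, so its sum needs no splitting. The last
            -- term replaces (δ + u) h j by its threshold bound for active j. The terms u a add up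
            -- to u ε, cancelling the - u ε from the last terms and leaving an excess of only δ (1 -
            -- ε), while every active user keeps u a in reserve.
            f : Fin N → ℝ
            f j = ((h j + (- u) * h j) + (u * a) * 1#) + K * activeβ j

            active-bound : ∀ {j} → Active Q j → x j ≤ f j - u * a
            active-bound {j} actⱼ = ≤-by
              (diff (bounded 1≤κ xiE≤κyi j) ⊞ (<⇒≤ 0<δ ⊞ <⇒≤ 0<u) ⊠ diff hj≤thr)
              (trans (solve 8 (λ x d u h e b r a →
                  ((num 1 :+ d) :* h :- x) :+ (d :+ u) :* ((num 1 :- e) :* (b :* r) :- h)
                  := ((h :+ (:- u) :* h) :+ (u :* a) :* num 1) :+ ((d :+ u) :* (num 1 :- e)) :* r :* b
                       :- u :* a :- x)
                  refl (x j) δ u (h j) ε (β j) (B ⁻¹) a)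
                (+-congʳ (+-congʳ (+-congˡ (*-congˡ (sym (active-β actⱼ)))))))
              where
              hj≤thr : h j ≤ thr j
              hj≤thr = ≮⇒≥ λ thr<hj → none (j , actⱼ , λ hj<thr → <⇒≱ thr<hj (<⇒≤ hj<thr))

            -- Off the floor an idle user loses the factor 1 - u, its own factor being 1. On the
            -- floor, (1 - u) h j + u a is still at least a.
            idle-bound : ∀ {j} → ¬ Active Q j → g j ≈ 0# → x j ≤ f j
            idle-bound {j} ¬act gj≈0 = ≤-trans (
              [ (λ xj≤a → ≤-by (diff xj≤a ⊞ diff u≤1 ⊠ diff (a≤h j))
                  (solve 4 (λ x a u h → (a :- x) :+ (num 1 :- u) :* (h :- a)
                    := (num 1 :- u) :* h :+ u :* a :- x) refl (x j) a u (h j)))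
              , (λ xjE≤κyj → ≤-trans (xj≤[1-u]hj xjE≤κyj)
                  (≤-by (<⇒≤ 0<u ⊠ <⇒≤ 0<a)
                    (solve 2 (λ w v → w := v :+ w :- v) refl (u * a) ((1# - u) * h j))))
              ]′ (dominated xiE≤κyi j))
              (≤-reflexive (trans
                (solve 4 (λ u h a K → (num 1 :- u) :* h :+ u :* a
                  := ((h :+ (:- u) :* h) :+ (u :* a) :* num 1) :+ K :* num 0) refl u (h j) a K)
                (+-congˡ (*-congˡ (sym (idle-β ¬act))))))
              where
              Gj≈1 : G j ≈ 1#
              Gj≈1 = trans (G-cong gj≈0) (trans (exp-cong (zeroʳ η)) exp-0)

              xj≤[1-u]hj : x j * E ≤ κ * y j → x j ≤ (1# - u) * h j
              xj≤[1-u]hj p = *-cancelʳ-≤ 0<E (≤-by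
                (diff (≤-respʳ-≈ (*-congˡ (trans (*-congˡ Gj≈1) (*-identityʳ (h j)))) p)
                  ⊞ <⇒≤ (0<h j) ⊠ diff 1+δ≤[1-u]E)
                (solve 5 (λ x E k h u → (k :* h :- x :* E) :+ h :* ((num 1 :- u) :* E :- k)
                  := (num 1 :- u) :* h :* E :- x :* E) refl (x j) E κ (h j) u))

            x≤f : ∀ j → x j ≤ f j
            x≤f j = from (classify j)
              where
              weaken : x j ≤ f j - u * a → x j ≤ f j
              weaken p = ≤-by (diff p ⊞ <⇒≤ 0<u ⊠ <⇒≤ 0<a)
                (solve 3 (λ x f w → f :- w :- x :+ w := f :- x) refl (x j) (f j) (u * a))

              from : Class j → x j ≤ f j
              from (below actⱼ _ _) = weaken (active-bound actⱼ)
              from (above actⱼ _ _) = weaken (active-bound actⱼ)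
              from (idle ¬act eq)   = idle-bound ¬act eq

            sum-f : sum f ≈ 1# + δ * (1# - ε)
            sum-f = begin
              sum f
                ≈⟨ sum-+-* _ K activeβ ⟩
              sum (λ j → (h j + (- u) * h j) + (u * a) * 1#) + K * B
                ≈⟨ +-cong (sum-+-* {N} _ (u * a) (λ _ → 1#)) (x/y*y≈x _ (0<B act)) ⟩
              (sum (λ j → h j + (- u) * h j) + (u * a) * sum {N} (λ _ → 1#)) + (δ + u) * (1# - ε)
                ≈⟨ +-congʳ (+-cong (sum-+-* h (- u) h) (*-congˡ (sum-1 N))) ⟩
              ((sum h + (- u) * sum h) + (u * a) * n) + (δ + u) * (1# - ε)
                ≈⟨ +-congʳ (+-cong (+-cong (proj₁ h∈Δ) (*-congˡ (proj₁ h∈Δ)))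
                     (trans (*-assoc u a n) (*-congˡ an≈ε))) ⟩
              ((1# + (- u) * 1#) + u * ε) + (δ + u) * (1# - ε)
                ≈⟨ solve 3 (λ u e d → ((num 1 :+ (:- u) :* num 1) :+ u :* e) :+ (d :+ u) :* (num 1 :- e)
                     := num 1 :+ d :* (num 1 :- e)) refl u ε δ ⟩
              1# + δ * (1# - ε) ∎
              where open SetoidReasoning setoid

            impossible : ⊥
            impossible = no-gap
              (<-by (0<δ ⊞ˡ <⇒≤ 0<δ ⊠ <⇒≤ 0<ε) (begin
                δ + δ * ε
                  ≈⟨ solve 2 (λ d e → d :+ d :* e := num 1 :+ d :* num 2 :- (num 1 :+ d :* (num 1 :- e))) refl δ ε ⟩
                1# + δ * fromℕ 2 - (1# + δ * (1# - ε))
                  ≈⟨ +-cong (+-congˡ 2δ≈ua) (-‿cong (sym sum-f)) ⟩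
                1# + u * a - sum f ∎))
              x≤f i (active-bound act)
              where open SetoidReasoning setoid

        cases : x i < h i * κ → Dec (∃ λ k → Active Q k × ¬ h k < thr k) → ⊥
        cases lt (yes (k , actₖ , ¬lowₖ)) = Above.impossible lt actₖ ¬lowₖ
        cases lt (no none)                = AllBelow.impossible lt none

      -- An active user is multiplied by at least exp η = exp (- u) `E`, and `y≤xE` says that
      -- normalising divides by at most `E`.
      decay : ∀ {i} → Active Q i → h i * exp (- u) ≤ x i
      decay {i} act = *-cancelʳ-≤ 0<E (≤-trans
        (≤-by (<⇒≤ (0<h i) ⊠ diff (expη≤G (classify i)))
          (trans (solve 3 (λ h G x → h :* (G :- x) := h :* G :- h :* x) refl (h i) (G i) (exp η))
            (+-congˡ (-‿cong (trans (*-congˡ expη≈) (solve 3 (λ h v E → h :* (v :* E) := h :* v :* E) refl (h i) (exp (- u)) E))))))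
        (y≤xE i))
        where
        expη≈ : exp η ≈ exp (- u) * E
        expη≈ = trans (exp-cong (solve 2 (λ h l → h := (:- (h :* l)) :+ h :* (num 1 :+ l)) refl η λ₀))
          (exp-+ (- u) _)

        expη≤G : Class i → exp η ≤ G i
        expη≤G (below _ _ eq) = ≤-respʳ-≈ (sym (G-cong eq)) (exp-mono (≤-by (<⇒≤ 0<u)
          (solve 2 (λ h l → h :* l := h :* (num 1 :+ l) :- h) refl η λ₀)))
        expη≤G (above _ _ eq) = ≤-reflexive (sym (trans (G-cong eq) (exp-cong (*-identityʳ η))))
        expη≤G (idle ¬act _)  = contradiction act ¬act

    -- Number of growth steps from the floor to 1

    r : ℝ
    r = δ - δ * δ

    -- Here `r` is a lower bound for ln (1 + δ): exp (- r) ≥ 1 - r, and (1 + δ) (1 - r) = 1 + δ³ ≥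
    -- 1.
    exp-r≤1+δ : exp r ≤ 1# + δ
    exp-r≤1+δ = *-cancelʳ-≤ 0<1-r
      (≤-by (<⇒≤ (exp-pos r) ⊠ diff (1+x≤exp (- r)) ⊞ <⇒≤ 0<δ ⊠ <⇒≤ 0<δ ⊠ <⇒≤ 0<δ)
        (trans (solve 3 (λ e f d →
                  e :* (f :- (num 1 :+ :- (d :- d :* d))) :+ d :* d :* d
                  := e :* f :+ d :* d :* d :- e :* (num 1 :- (d :- d :* d))) refl (exp r) (exp (- r)) δ)
        (+-congʳ (trans (+-congʳ (exp-neg r))
          (solve 1 (λ d → num 1 :+ d :* d :* d := (num 1 :+ d) :* (num 1 :- (d :- d :* d))) refl δ)))))
      where
      0<1-r : 0# < 1# - r
      0<1-r = <-by (0<δ ⊠⁺ 0<δ ⊞ˡ diff 80δ≤1 ⊞ˡ 0≤fromℕ 79 ⊠ <⇒≤ 0<δ)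
        (solve 1 (λ d → d :* d :+ (num 1 :- d :* num 80) :+ num 79 :* d
           := num 1 :- (d :- d :* d) :- num 0) refl δ)

    exp-jr≤[1+δ]^j : ∀ j → exp (fromℕ j * r) ≤ (1# + δ) ^ j
    exp-jr≤[1+δ]^j zero = ≤-reflexive (trans (exp-cong (zeroˡ r)) exp-0)
    exp-jr≤[1+δ]^j (suc j) = ≤-by
      (diff exp-r≤1+δ ⊠ <⇒≤ (exp-pos (fromℕ j * r)) ⊞ (0≤1 ⊞ <⇒≤ 0<δ) ⊠ diff (exp-jr≤[1+δ]^j j))
      (trans (solve 4 (λ e f d p → ((num 1 :+ d) :- e) :* f :+ (num 1 :+ d) :* (p :- f)
                := (num 1 :+ d) :* p :- e :* f) refl (exp r) (exp (fromℕ j * r)) δ ((1# + δ) ^ j))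
        (+-congˡ (-‿cong (trans (sym (exp-+ r (fromℕ j * r)))
          (exp-cong (solve 2 (λ r j → r :+ j :* r := (num 1 :+ j) :* r) refl r (fromℕ j)))))))

    -- More than p̃ - 3 steps of growth by the factor 1 + δ take the floor a to 1.
    warm : ∀ p → p̃ N ε η < fromℕ (3 ℕ.+ p) → ∀ {j} → p ℕ.≤ j → 1# ≤ a * (1# + δ) ^ j
    warm p p̃<p+3 {j} p≤j = ≤-by (<⇒≤ 0<a ⊠ diff n/ε≤[1+δ]^j)
      (trans (solve 3 (λ a x y → a :* (x :- y) := a :* x :- a :* y) refl a ((1# + δ) ^ j) (n / ε))
        (+-congˡ (-‿cong a*n/ε≈1)))
      where
      l P J : ℝ
      l = ln (n / ε)
      P = p̃ N ε η
      J = fromℕ j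

      P≤J+3 : P ≤ fromℕ 3 + J
      P≤J+3 = ≤-by (diff (<⇒≤ p̃<p+3) ⊞ diff (fromℕ-mono p≤j))
        (solve 3 (λ P p J → (num 1 :+ (num 1 :+ (num 1 :+ p))) :- P :+ (J :- p) := num 3 :+ J :- P)
          refl P (fromℕ p) J)

      -- Since 2 l = p̃ δ and j ≥ p̃ - 3, it is enough that 2 (p̃ - 3) (1 - δ) ≥ p̃, which p̃ ≥ 16
      -- and δ ≤ 1/80 ensure.
      l≤Jr : l ≤ J * r
      l≤Jr = *-cancelʳ-≤ (0<fromℕ 1) (≤-by
        (<⇒≤ 0<δ ⊠ (0≤fromℕ 2 ⊠ diff P≤J+3 ⊠ (diff 80δ≤1 ⊞ 0≤fromℕ 79 ⊠ <⇒≤ 0<δ)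
          ⊞ diff 16≤p̃ ⊠ (diff 80δ≤1 ⊞ 0≤fromℕ 78 ⊠ <⇒≤ 0<δ)
          ⊞ (diff 80δ≤1 ⊞ 0≤fromℕ 9 ⊞ 0≤fromℕ 54 ⊠ <⇒≤ 0<δ)))
        (trans (solve 3 (λ d P J → d :* (num 2 :* (num 3 :+ J :- P) :* ((num 1 :- d :* num 80) :+ num 79 :* d)
             :+ (P :- num 16) :* ((num 1 :- d :* num 80) :+ num 78 :* d)
             :+ ((num 1 :- d :* num 80) :+ num 9 :+ num 54 :* d))
             := J :* (d :- d :* d) :* num 2 :- P :* d) refl δ P J)
          (+-congˡ (-‿cong (trans p̃δ≈2ln (*-comm (fromℕ 2) l))))))

      n/ε≤[1+δ]^j : n / ε ≤ (1# + δ) ^ j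
      n/ε≤[1+δ]^j = ≤-respˡ-≈ (exp-ln 0<n/ε) (≤-trans (exp-mono l≤Jr) (exp-jr≤[1+δ]^j j))

    -- The allocation of one user along a run

    module Run (T : ℕ) (L h h′ : ℕ → Fin N → ℝ)
      (0≤L : ∀ τ → 1 ℕ.≤ τ → τ ℕ.≤ T → ∀ j → 0# ≤ L τ j)
      (run : IsAlgorithm2Run ε η β T L h) (i : Fin N)
      (h′≈target : ∀ τ → 1 ℕ.≤ τ → τ ℕ.≤ T → h′ τ i ≈ (1# - fromℕ 2 * ε) * share β i)
      where
      open IsAlgorithm2Run run

      target P : ℝ
      target = (1# - fromℕ 2 * ε) * share β i
      P      = p̃ N ε η

      Q : ℕ → Fin N → ℝ
      Q = queue L h

      V V′ Λ : ℕ → ℝ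
      V  = W L h i
      V′ = W L h′ i
      Λ  = Load L h i

      0≤target : 0# ≤ target
      0≤target = ≤-respʳ-≈ (solve 1 (λ e → (num 1 :- e :* num 10) :+ num 8 :* e := num 1 :- num 2 :* e) refl ε)
        (diff 10ε≤1 ⊞ 0≤fromℕ 8 ⊠ <⇒≤ 0<ε) ⊠ <⇒≤ (0<share i)

      target≤share : target ≤ share β i
      target≤share = ≤-by (0≤fromℕ 2 ⊠ <⇒≤ 0<ε ⊠ <⇒≤ (0<share i))
        (solve 2 (λ e s → num 2 :* e :* s := s :- (num 1 :- num 2 :* e) :* s) refl ε (share β i))

      target≤1 : target ≤ 1#
      target≤1 = ≤-trans target≤share (share≤1 i)

      simplex : ∀ t → 1 ℕ.≤ t → t ℕ.≤ suc T → TruncatedSimplex ε (h t)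
      simplex (suc zero)    _ _          = initial
      simplex (suc (suc t)) _ (ℕ.s≤s p) = proj₁ (step (suc t) (ℕ.s≤s ℕ.z≤n) p)

      -- The split is at (1 - ε) share, which is below every threshold. Under it `growth` applies;
      -- from it upwards a single `decay` cannot go below `target`.
      advance : ∀ t → t ℕ.< T → Active (Q (suc t)) i →
                target ≤ h (suc (suc t)) i ⊎ h (suc t) i * (1# + δ) ≤ h (suc (suc t)) i
      advance t t<T act = by-cases (h (suc t) i <? (1# - ε) * share β i)
        where
        open Step (Q (suc t)) (h (suc t)) (h (suc (suc t)))
          (simplex (suc t) (ℕ.s≤s ℕ.z≤n) (ℕ.m≤n⇒m≤1+n t<T)) (step (suc t) (ℕ.s≤s ℕ.z≤n) t<T)

        by-cases : Dec (h (suc t) i < (1# - ε) * share β i) →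
                   target ≤ h (suc (suc t)) i ⊎ h (suc t) i * (1# + δ) ≤ h (suc (suc t)) i
        by-cases (yes lt) = inj₂ (growth act (<-≤-trans lt (share≤thr act i)))
        by-cases (no ¬lt) = inj₁ (≤-trans
          (≤-by (<⇒≤ (0<share i) ⊠ diff [1-2ε]≤exp[-u][1-ε] ⊞ <⇒≤ (exp-pos (- u)) ⊠ diff (≮⇒≥ ¬lt))
            (solve 4 (λ s e x h → s :* (x :* (num 1 :- e) :- (num 1 :- num 2 :* e))
                                    :+ x :* (h :- (num 1 :- e) :* s)
                := h :* x :- (num 1 :- num 2 :* e) :* s) refl (share β i) ε (exp (- u)) (h (suc t) i)))
          (decay act))

      module BusyPeriod (s u : ℕ) (idle : ¬ Active (Q (suc s)) i)
        (busy : ∀ k → k ℕ.< u → Active (Q (suc (suc (k ℕ.+ s)))) i) where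

        -- The floor supplies the start, whatever happened while the user was idle. Both outcomes of
        -- `advance` preserve a `target` once reached.
        climb : ∀ j → j ℕ.≤ u → j ℕ.+ s ℕ.< T →
                target ≤ h (suc (suc (j ℕ.+ s))) i ⊎ a * (1# + δ) ^ j ≤ h (suc (suc (j ℕ.+ s))) i
        climb zero _ s<T = inj₂ (≤-respˡ-≈ (sym (*-identityʳ a))
          (proj₂ (simplex (suc (suc s)) (ℕ.s≤s ℕ.z≤n) (ℕ.s≤s s<T)) i))
        climb (suc j) j<u lt with advance (suc (j ℕ.+ s)) lt (busy j j<u)
        ... | inj₁ reached = inj₁ reached
        ... | inj₂ grown with climb j (ℕ.<⇒≤ j<u) (ℕ.<⇒≤ lt)
        ...   | inj₁ reached = inj₁ (≤-trans reached (≤-trans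
          (≤-by (≤-trans 0≤target reached ⊠ <⇒≤ 0<δ)
            (solve 2 (λ x d → x :* d := x :* (num 1 :+ d) :- x) refl (h (suc (suc (j ℕ.+ s))) i) δ)) grown))
        ...   | inj₂ above = inj₂ (≤-trans
          (≤-respˡ-≈ (solve 3 (λ a p d → a :* p :* (num 1 :+ d) := a :* ((num 1 :+ d) :* p)) refl a ((1# + δ) ^ j) δ)
            (*-monoʳ-≤ (0≤1 ⊞ <⇒≤ 0<δ) above)) grown)

        settled : ∀ p → P < fromℕ (3 ℕ.+ p) → ∀ j → p ℕ.≤ j → j ℕ.≤ u → j ℕ.+ s ℕ.< T →
                  target ≤ h (suc (suc (j ℕ.+ s))) i
        settled p P< j p≤j j≤u lt = [ (λ q → q) , ≤-trans (≤-trans target≤1 (warm p P< p≤j)) ]′ (climb j j≤u lt)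

      -- Comparison of cumulative work

      0≤h : ∀ τ → 1 ℕ.≤ τ → τ ℕ.≤ T → 0# ≤ h τ i
      0≤h τ 1≤τ τ≤T = ≤-trans (<⇒≤ 0<a) (proj₂ (simplex τ 1≤τ (ℕ.m≤n⇒m≤1+n τ≤T)) i)

      0≤w : ∀ τ → 1 ℕ.≤ τ → τ ℕ.≤ T → 0# ≤ work L h τ i
      0≤w τ 1≤τ τ≤T = 0≤work L h i τ (0≤h τ 1≤τ τ≤T) (0≤L τ 1≤τ τ≤T i)

      V-mono : ∀ {m n} → m ℕ.≤ n → n ℕ.≤ T → V m ≤ V n
      V-mono m≤n n≤T = sumUpTo-extend {f = λ τ → work L h τ i}
        (λ τ 1≤τ τ≤n → 0≤w τ 1≤τ (ℕ.≤-trans τ≤n n≤T)) m≤n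

      Λ-mono : ∀ {m n} → m ℕ.≤ n → n ℕ.≤ T → Λ m ≤ Λ n
      Λ-mono m≤n n≤T = sumUpTo-extend {f = λ τ → L τ i}
        (λ τ 1≤τ τ≤n → 0≤L τ 1≤τ (ℕ.≤-trans τ≤n n≤T) i) m≤n

      V′-bound : ∀ s k → k ℕ.+ s ℕ.≤ T → V′ (k ℕ.+ s) ≤ Λ s + fromℕ k * target
      V′-bound s k k+s≤T = W-linear-bound L h′ i s k
        (λ τ 1≤τ τ≤ → ≤-reflexive (h′≈target τ 1≤τ (ℕ.≤-trans τ≤ k+s≤T)))

      -- Written off are step s + 1 and the next p steps, in which the allocation climbs. From step
      -- s + p + 2 on it is at least `target`, and it is fully used as long as the queue is nonempty
      -- afterwards.
      V-bound : ∀ p {s u} → P < fromℕ (3 ℕ.+ p) → ¬ Active (Q (suc s)) i →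
                (∀ k → k ℕ.< u → Active (Q (suc (suc (k ℕ.+ s)))) i) →
                ∀ k → k ℕ.≤ u → k ℕ.+ s ℕ.≤ T →
                Λ s + (fromℕ k - fromℕ (suc p)) * target ≤ V (k ℕ.+ s)
      V-bound p {s} {u} P< idle busy = bound
        where
        open BusyPeriod s u idle busy

        -- The coefficient of `target` is at most 0 here, so the load served by the idle time is
        -- enough.
        cold : ∀ k → k ℕ.≤ suc p → k ℕ.+ s ℕ.≤ T →
               Λ s + (fromℕ k - fromℕ (suc p)) * target ≤ V (k ℕ.+ s)
        cold k k≤1+p k+s≤T = ≤-trans
          (≤-by (diff (fromℕ-mono k≤1+p) ⊠ 0≤target)
            (solve 4 (λ k p t l → (p :- k) :* t := l :- (l :+ (k :- p) :* t)) refl (fromℕ k) (fromℕ (suc p)) target (Λ s)))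
          (≤-trans (Load≤W L h i s idle) (V-mono (ℕ.m≤n+m s k) k+s≤T))

        bound : ∀ k → k ℕ.≤ u → k ℕ.+ s ℕ.≤ T →
                Λ s + (fromℕ k - fromℕ (suc p)) * target ≤ V (k ℕ.+ s)
        bound zero k≤u k+s≤T = cold zero ℕ.z≤n k+s≤T
        bound (suc zero) k≤u k+s≤T = cold 1 (ℕ.s≤s ℕ.z≤n) k+s≤T
        bound (suc (suc j)) k≤u k+s≤T = extend (p ℕ.≤? j) (bound (suc j) (ℕ.<⇒≤ k≤u) (ℕ.<⇒≤ k+s≤T))
          where
          extend : Dec (p ℕ.≤ j) →
                   Λ s + (fromℕ (suc j) - fromℕ (suc p)) * target ≤ V (suc j ℕ.+ s) →
                   Λ s + (fromℕ (suc (suc j)) - fromℕ (suc p)) * target ≤ V (suc (suc j) ℕ.+ s)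
          extend (no p≰j)  _  = cold (suc (suc j)) (ℕ.s≤s (ℕ.≰⇒> p≰j)) k+s≤T
          extend (yes p≤j) IH = ≤-by
            (diff IH ⊞ diff (settled p P< j p≤j (ℕ.<⇒≤ (ℕ.<⇒≤ k≤u)) (ℕ.<⇒≤ k+s≤T)))
            (trans (solve 6 (λ v l k p t h → (v :- (l :+ (k :- p) :* t)) :+ (h :- t)
                      := v :+ h :- (l :+ ((num 1 :+ k) :- p) :* t))
                    refl (V (suc j ℕ.+ s)) (Λ s) (fromℕ (suc j)) (fromℕ (suc p)) target (h (suc (suc j ℕ.+ s)) i))
              (+-congʳ (sym (trans (W-suc L h i (suc j ℕ.+ s)) (+-congˡ (fully-used (busy (suc j) k≤u)))))))

      -- The extra step may empty the queue, so its work is counted only as nonnegative.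
      V-bound-suc : ∀ p {s u} → P < fromℕ (3 ℕ.+ p) → ¬ Active (Q (suc s)) i →
                    (∀ k → k ℕ.< u → Active (Q (suc (suc (k ℕ.+ s)))) i) → u ℕ.+ s ℕ.< T →
                    Λ s + (fromℕ u - fromℕ (suc p)) * target ≤ V (suc (u ℕ.+ s))
      V-bound-suc p {u = u} P< idle busy lt =
        ≤-trans (V-bound p P< idle busy u ℕ.≤-refl (ℕ.<⇒≤ lt)) (V-mono (ℕ.n≤1+n _) lt)

      -- Let s + 1 be the last idle time up to p + 2 + t. If t ≤ s, all load up to t has been
      -- served, and no allocation can do more. Otherwise u = p + 1 + (t - s), so the steps not
      -- written off number t - s, as many as the comparison has after s.
      catch-up : ∀ p → P < fromℕ (3 ℕ.+ p) → ∀ t → suc (suc p) ℕ.+ t ℕ.≤ T →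
                 V′ t ≤ V (suc (suc p) ℕ.+ t)
      catch-up p P< t n≤T with last-idle L h i (suc p ℕ.+ t)
      ... | s , u , n≡ , idle , busy = by-cases (ℕ.≤-total t s)
        where
        u+s<T : u ℕ.+ s ℕ.< T
        u+s<T = ≡.subst (ℕ._< T) n≡ n≤T

        s≤n : s ℕ.≤ suc (suc p) ℕ.+ t
        s≤n = ≡.subst (λ m → s ℕ.≤ suc m) (≡.sym n≡) (ℕ.m≤n⇒m≤1+n (ℕ.m≤n+m s u))

        by-cases : t ℕ.≤ s ⊎ s ℕ.≤ t → V′ t ≤ V (suc (suc p) ℕ.+ t)
        by-cases (inj₁ t≤s) = ≤-trans (W≤Load L h′ i t) (≤-trans (Λ-mono t≤s (ℕ.≤-trans s≤n n≤T))
          (≤-trans (Load≤W L h i s idle) (V-mono s≤n n≤T)))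
        by-cases (inj₂ s≤t) = ≡.subst (λ m → V′ m ≤ V (suc (suc p) ℕ.+ t)) k+s≡t
          (≤-trans (V′-bound s k (≡.subst (ℕ._≤ T) (≡.sym k+s≡t) (ℕ.≤-trans (ℕ.m≤n+m t _) n≤T)))
          (≤-trans (≤-reflexive (+-congˡ (*-congʳ k≈)))
            (≡.subst (λ m → Λ s + (fromℕ u - fromℕ (suc p)) * target ≤ V (suc m)) (≡.sym n≡)
              (V-bound-suc p P< idle busy u+s<T))))
          where
          k : ℕ
          k = t ℕ.∸ s

          k+s≡t : k ℕ.+ s ≡ t
          k+s≡t = ℕ.m∸n+n≡m s≤t

          u≡ : u ≡ suc p ℕ.+ k
          u≡ = ℕ.+-cancelʳ-≡ s u (suc p ℕ.+ k)
            (≡.trans (≡.sym n≡) (≡.trans (≡.cong (suc p ℕ.+_) (≡.sym k+s≡t)) (≡.sym (ℕ.+-assoc (suc p) k s))))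

          k≈ : fromℕ k ≈ fromℕ u - fromℕ (suc p)
          k≈ = trans (solve 2 (λ p k → k := p :+ k :- p) refl (fromℕ (suc p)) (fromℕ k))
            (+-congʳ (trans (sym (×-homo-+ 1# (suc p) k)) (reflexive (≡.cong fromℕ (≡.sym u≡)))))

      -- After s the comparison has at most u + 1 steps of `target` and the algorithm at least u -
      -- (p + 1); the difference is p + 2.
      lag : ∀ p → P < fromℕ (3 ℕ.+ p) → ∀ t → t ℕ.< T →
            V′ (suc t) - fromℕ (2 ℕ.+ p) * target ≤ V (suc t)
      lag p P< t t<T with last-idle L h i t
      ... | s , u , ≡.refl , idle , busy = ≤-by
        (diff (V′-bound s (suc u) t<T) ⊞ diff (V-bound-suc p P< idle busy t<T))
        (solve 6 (λ l u p t v v′ →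
            (l :+ (num 1 :+ u) :* t :- v′) :+ (v :- (l :+ (u :- p) :* t))
            := v :- (v′ :- (num 1 :+ p) :* t))
          refl (Λ s) (fromℕ u) (fromℕ (suc p)) target (V (suc (u ℕ.+ s))) (V′ (suc (u ℕ.+ s))))

      0≤P : 0# ≤ P
      0≤P = ≤-trans (0≤fromℕ 16) 16≤p̃

      -- Writes the integer part of p̃ as p + 2: a delay of p + 2 steps fits into p̃, and `warm`
      -- applies to p.
      floor-P : ∀ m → P ≤ fromℕ m → ∃ λ p → fromℕ (2 ℕ.+ p) ≤ P × P < fromℕ (3 ℕ.+ p)
      floor-P m P≤m = split (floor P 0≤P m P≤m)
        where
        too-small : ∀ {k} → k ℕ.≤ 16 → ¬ P < fromℕ k
        too-small k≤16 P<k = <⇒≱ P<k (≤-trans (fromℕ-mono k≤16) 16≤p̃)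

        split : (∃ λ k → fromℕ k ≤ P × P < fromℕ (suc k)) →
                ∃ λ p → fromℕ (2 ℕ.+ p) ≤ P × P < fromℕ (3 ℕ.+ p)
        split (suc (suc p) , bounds) = p , bounds
        split (0 , _ , P<1) = contradiction P<1 (too-small (ℕ.s≤s ℕ.z≤n))
        split (1 , _ , P<2) = contradiction P<2 (too-small (ℕ.s≤s (ℕ.s≤s ℕ.z≤n)))

      delayed : ∀ t → 1 ℕ.≤ t → fromℕ t ≤ fromℕ T - P →
                V′ t ≤ sumUpToℝ T (fromℕ t + P) (λ τ → work L h τ i)
      -- The horizon serves as the integer bound on p̃ from which its integer part is found.
      delayed t 1≤t t≤T-P = wait (floor-P T P≤T)
        where
        P≤T : P ≤ fromℕ T
        P≤T = ≤-by (diff t≤T-P ⊞ 0≤fromℕ t)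
          (solve 3 (λ T P t → T :- P :- t :+ t := T :- P) refl (fromℕ T) P (fromℕ t))

        wait : (∃ λ p → fromℕ (2 ℕ.+ p) ≤ P × P < fromℕ (3 ℕ.+ p)) →
               V′ t ≤ sumUpToℝ T (fromℕ t + P) (λ τ → work L h τ i)
        wait (p , p+2≤P , P<) = ≤-trans (catch-up p P< t n≤T)
          (sumUpTo≤sumUpToℝ {f = λ τ → work L h τ i} 0≤w n≤T n≤t+P)
          where
          n≤t+P : fromℕ (2 ℕ.+ p ℕ.+ t) ≤ fromℕ t + P
          n≤t+P = ≤-by (diff p+2≤P)
            (trans (solve 3 (λ P p t → P :- p := t :+ P :- (p :+ t)) refl P (fromℕ (2 ℕ.+ p)) (fromℕ t))
              (+-congˡ (-‿cong (sym (×-homo-+ 1# (2 ℕ.+ p) t)))))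

          n≤T : 2 ℕ.+ p ℕ.+ t ℕ.≤ T
          n≤T = fromℕ-cancel (≤-trans n≤t+P (≤-by (diff t≤T-P)
            (solve 3 (λ T P t → T :- P :- t := T :- (t :+ P)) refl (fromℕ T) P (fromℕ t))))

      lagging : ∀ t → 1 ℕ.≤ t → t ℕ.≤ T → V′ t - share β i * P ≤ V t
      lagging (suc t) _ t<T = by-cases (P ≤? fromℕ (suc t))
        where
        late : (∃ λ p → fromℕ (2 ℕ.+ p) ≤ P × P < fromℕ (3 ℕ.+ p)) →
               V′ (suc t) - share β i * P ≤ V (suc t)
        late (p , p+2≤P , P<) = ≤-trans
          (≤-by (diff target≤share ⊠ 0≤P ⊞ 0≤target ⊠ diff p+2≤P)
            (solve 5 (λ s t P p v → (s :- t) :* P :+ t :* (P :- p) := v :- p :* t :- (v :- s :* P))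
              refl (share β i) target P (fromℕ (2 ℕ.+ p)) (V′ (suc t))))
          (lag p P< t t<T)

        V′≤ : V′ (suc t) ≤ 0# + fromℕ (suc t) * target
        V′≤ = ≡.subst (λ m → V′ m ≤ 0# + fromℕ (suc t) * target) (ℕ.+-identityʳ (suc t))
          (V′-bound 0 (suc t) (≡.subst (ℕ._≤ T) (≡.sym (ℕ.+-identityʳ (suc t))) t<T))

        -- Without an integer bound on p̃ from the elapsed time, the allowance share p̃ already
        -- exceeds all work that t + 1 steps of `target` can do.
        by-cases : Dec (P ≤ fromℕ (suc t)) → V′ (suc t) - share β i * P ≤ V (suc t)
        by-cases (yes P≤t) = late (floor-P (suc t) P≤t)
        by-cases (no P≰t)  = ≤-trans
          (≤-by (diff V′≤ ⊞ diff target≤share ⊠ 0≤P ⊞ 0≤target ⊠ diff (<⇒≤ (≰⇒> P≰t)))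
            (solve 5 (λ s t P k v → (num 0 :+ k :* t :- v) :+ (s :- t) :* P :+ t :* (P :- k)
                := num 0 :- (v :- s :* P))
              refl (share β i) target P (fromℕ (suc t)) (V′ (suc t))))
          (V-mono {0} {suc t} ℕ.z≤n t<T)

theorem6 : ∀ {c ℓ₁ ℓ₂} (R : RealNumbers c ℓ₁ ℓ₂) →
    let open RealNumbers R
        open Scheduling R
    in
    (N T : ℕ) → 2 ℕ.≤ N →
    (ε η : ℝ) →
    0# < ε → ε ≤ 1# / fromℕ 10 →
    0# < η → η ≤ 1# / fromℕ 3 →
    (β : Fin N → ℝ) → (∀ i → 0# ≤ β i) → 0# < sum β →
    (∀ i → (exp (η * (1# + λ′ N ε)) / (1# - ε)) * (ε / fromℕ N) ≤ share β i) →
    (L : ℕ → Fin N → ℝ) →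
    (∀ τ → 1 ℕ.≤ τ → τ ℕ.≤ T → ∀ j → 0# ≤ L τ j) →
    (h : ℕ → Fin N → ℝ) → IsAlgorithm2Run ε η β T L h →
    (i : Fin N) →
    (h′ : ℕ → Fin N → ℝ) →
    (∀ τ → 1 ℕ.≤ τ → τ ℕ.≤ T → IsAllocation (h′ τ)) →
    (∀ τ → 1 ℕ.≤ τ → τ ℕ.≤ T → h′ τ i ≈ (1# - fromℕ 2 * ε) * share β i) →
    (∀ t → 1 ℕ.≤ t → fromℕ t ≤ fromℕ T - p̃ N ε η →
      sumUpTo t (λ τ → work L h′ τ i)
        ≤ sumUpToℝ T (fromℕ t + p̃ N ε η) (λ τ → work L h τ i))
    ×
    (∀ t → 1 ℕ.≤ t → t ℕ.≤ T →
      sumUpTo t (λ τ → work L h′ τ i) - share β i * p̃ N ε η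
        ≤ sumUpTo t (λ τ → work L h τ i))
theorem6 R N T 2≤N ε η 0<ε ε≤1/10 0<η η≤1/3 β 0≤β 0<Σβ large-share L 0≤L h run i h′ _ h′≈target =
  delayed , lagging
  where
  open Algorithm2.Guarantee R N (ℕ.<⇒≤ 2≤N) ε η 0<ε ε≤1/10 0<η η≤1/3 β 0≤β 0<Σβ large-share
  open Run T L h h′ 0≤L run i h′≈target
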